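{- There is no complete problem for $\mathsf{BPP}^0$. That is, there is no communication problem $\mathcal{Q} \in \mathsf{BPP}^0$ such that every communication problem $\mathcal{P} \in \mathsf{BPP}^0$ satisfies $\mathsf{D}^{\mathcal{Q}}(\mathcal{P}) = O(1)$.
   Context: A communication problem is a sequence $\mathcal{P} = (P_N)_{N \in \mathbb{N}}$ where $P_N \in \{0,1\}^{N\times N}$ is an $N \times N$ Boolean matrix. For a Boolean matrix $M$, $\mathsf{R}(M)$ is the minimum cost (worst-case number of bits communicated) of a two-way public-coin randomized communication protocol (Alice holds a row index, Bob a column index) that, on every input $(x,y)$, outputs $M(x,y)$ with probability at least $2/3$. $\mathsf{BPP}^0$ is the set of all communication problems $\mathcal{P}$ for which there is a constant $c$ with $\mathsf{R}(P_N) \le c$ for all $N$. For a set $\mathcal{M}$ of Boolean matrices (a communication problem is also regarded as the set of its matrices), the query set $\mathsf{QS}(\mathcal{M})$ is the set of all matrices obtained from matrices in $\mathcal{M}$ by the operations: arbitrary row and column permutations; taking arbitrary submatrices; duplicating arbitrary rows or columns. For $P \in \{0,1\}^{N \times N}$, a deterministic communication protocol with oracle access to $\mathcal{M}$ is a binary tree in which each inner node $v$ is associated with an $N \times N$ matrix $Q_v \in \mathsf{QS}(\mathcal{M})$ and each leaf $\ell$ with a bit $b_\ell \in \{0,1\}$. An input $(x,y)$ (row $x$, column $y$) defines a root-to-leaf path: at node $v$ the entry $Q_v(x,y)$ decides whether to go left or right; the output is the bit of the leaf reached. The protocol computes $P$ if the output is $P(x,y)$ for every $(x,y)$. Its cost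 is the depth of the tree, and $\mathsf{D}^{\mathcal{M}}(P)$ is the minimum cost of such a protocol computing $P$ ($\infty$ if there is none). $\mathsf{D}^{\mathcal{Q}}(\mathcal{P}) = O(1)$ means that there is a constant $c$ with $\mathsf{D}^{\mathcal{Q}}(P_N) \le c$ for all $N$. -}

module Defs where

open import Data.Bool using (Bool; if_then_else_)
open import Data.Bool.Properties using (_≟_)
open import Data.Fin using (Fin; _<_; pinch)
open import Data.Fin.Permutation using (Permutation′; _⟨$⟩ʳ_)
open import Data.Integer using (+_)
open import Data.Nat using (ℕ; suc; _⊔_; _≤_; NonZero)
open import Data.Product using (∃-syntax; _×_)
open import Data.Rational as ℚ using (ℚ)
open import Data.Vec using (allFin; count)
open import Data.Vec.Functional using (Vector)
open import Relation.Binary.Core using (_Preserves_⟶_)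
open import Relation.Binary.PropositionalEquality using (_≡_)

Matrix : ℕ → ℕ → Set
Matrix m n = Vector (Vector Bool n) m

CommunicationProblem : Set
CommunicationProblem = ∀ N → Matrix N N

-- The cost of a deterministic protocol is the height of its tree: one bit is
-- sent at each inner node, and the transcript (the leaf) determines the output.

data Protocol (m n : ℕ) : Set where
  output : Bool → Protocol m n
  alice  : (Fin m → Bool) → (if-false if-true : Protocol m n) → Protocol m n
  bob    : (Fin n → Bool) → (if-false if-true : Protocol m n) → Protocol m n

run : ∀ {m n} → Protocol m n → Fin m → Fin n → Bool
run (output b)     x y = b
run (alice a π₀ π₁) x y = if a x then run π₁ x y else run π₀ x y
run (bob b π₀ π₁)   x y = if b y then run π₁ x y else run π₀ x y

cost : ∀ {m n} → Protocol m n → ℕ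
cost (output b)      = 0
cost (alice a π₀ π₁) = suc (cost π₀ ⊔ cost π₁)
cost (bob b π₀ π₁)   = suc (cost π₀ ⊔ cost π₁)

-- A public-coin protocol is a deterministic protocol chosen by a shared seed,
-- uniform on a finite nonempty set.  As `protocol` need not be injective, these
-- are exactly the distributions with rational weights on deterministic
-- protocols.  Real weights would give the same costs: only finitely many
-- (function, cost) pairs matter for protocols of cost at most c on a fixed
-- matrix, so existence of a suitable distribution is the feasibility of a
-- linear program with rational coefficients.

record PublicCoinProtocol (m n : ℕ) : Set where
  field
    seeds            : ℕ
    {{seeds-nonZero}} : NonZero seeds
    protocol         : Fin seeds → Protocol m n

  Pr[_,_outputs_] : Fin m → Fin n → Bool → ℚ
  Pr[ x , y outputs b ] =
    + count (λ r → run (protocol r) x y ≟ b) (allFin seeds) ℚ./ seeds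

open PublicCoinProtocol public

-- R[ M ]≤ c: the minimum cost of a public-coin protocol for M is at most c,
-- i.e. some such protocol costs at most c on every seed.

R[_]≤_ : ∀ {m n} → Matrix m n → ℕ → Set
R[_]≤_ {m} {n} M c =
  ∃[ Π ] (∀ x y → Pr[_,_outputs_] {m} {n} Π x y (M x y) ℚ.≥ + 2 ℚ./ 3)
       × (∀ r → cost (protocol Π r) ≤ c)

BPP⁰ : CommunicationProblem → Set
BPP⁰ 𝒫 = ∃[ c ] ∀ N → R[ 𝒫 N ]≤ c

MatrixSet : Set₁
MatrixSet = ∀ {m n} → Matrix m n → Set

data Matrices (𝒫 : CommunicationProblem) : ∀ {m n} → Matrix m n → Set where
  matrix : ∀ N → Matrices 𝒫 (𝒫 N)

-- `pinch i` is the monotone surjection Fin (suc m) → Fin m hitting i twice, so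
-- reindexing by it duplicates row (column) i.  Matrices are functions, so
-- without function extensionality `pointwise` is needed to identify matrices
-- having the same entries.

data QS (ℳ : MatrixSet) : ∀ {m n} → Matrix m n → Set where
  member          : ∀ {m n} {M : Matrix m n} → ℳ M → QS ℳ M
  permute         : ∀ {m n} {M : Matrix m n} (σ : Permutation′ m) (τ : Permutation′ n) →
                    QS ℳ M → QS ℳ (λ i j → M (σ ⟨$⟩ʳ i) (τ ⟨$⟩ʳ j))
  submatrix       : ∀ {m n m′ n′} {M : Matrix m n}
                    (f : Fin m′ → Fin m) (g : Fin n′ → Fin n) →
                    f Preserves _<_ ⟶ _<_ → g Preserves _<_ ⟶ _<_ →
                    QS ℳ M → QS ℳ (λ i j → M (f i) (g j))
  duplicateRow    : ∀ {m n} {M : Matrix m n} (r : Fin m) →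
                    QS ℳ M → QS ℳ (λ i j → M (pinch r i) j)
  duplicateColumn : ∀ {m n} {M : Matrix m n} (c : Fin n) →
                    QS ℳ M → QS ℳ (λ i j → M i (pinch c j))
  pointwise       : ∀ {m n} {M M′ : Matrix m n} →
                    (∀ i j → M i j ≡ M′ i j) → QS ℳ M → QS ℳ M′

data OracleProtocol (ℳ : MatrixSet) (N : ℕ) : Set where
  leaf  : Bool → OracleProtocol ℳ N
  query : (Q : Matrix N N) → QS ℳ Q →
          (if-false if-true : OracleProtocol ℳ N) → OracleProtocol ℳ N

runOracle : ∀ {ℳ : MatrixSet} {N} → OracleProtocol ℳ N → Fin N → Fin N → Bool
runOracle (leaf b)          x y = b
runOracle (query Q _ T₀ T₁) x y =
  if Q x y then runOracle T₁ x y else runOracle T₀ x y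

depth : ∀ {ℳ : MatrixSet} {N} → OracleProtocol ℳ N → ℕ
depth (leaf b)          = 0
depth (query Q _ T₀ T₁) = suc (depth T₀ ⊔ depth T₁)

-- D[ ℳ , P ]≤ c: the minimum depth of an oracle protocol computing P is at
-- most c; it fails for every c when no such protocol exists (the value ∞).

D[_,_]≤_ : MatrixSet → ∀ {N} → Matrix N N → ℕ → Set
D[_,_]≤_ ℳ {N} P c =
  ∃[ T ] (∀ x y → runOracle {ℳ} {N} T x y ≡ P x y) × depth T ≤ c

D[_,_]=O[1] : CommunicationProblem → CommunicationProblem → Set
D[ 𝒬 , 𝒫 ]=O[1] = ∃[ c ] ∀ N → D[ Matrices 𝒬 , 𝒫 N ]≤ c

{-# OPTIONS --safe #-}
module Submission where

-- Let 𝒬 have randomized cost at most c.  By the second moment method the index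
-- matrix (row a ∈ [t], column b ∈ {0,1}^t, entry b_a, possibly negated) has cost
-- more than c for large t, so it is not a submatrix of any matrix of 𝒬.  For this
-- t, the problem of deciding whether two strings are at Hamming distance less
-- than 2t has constant cost and does not reduce to 𝒬.  Suppose that a reduction
-- makes at most 2^d different queries to strings of a huge length.  Encode a
-- subset of [s] by a string in two ways, as a row and as a column, so that the
-- encodings of x and y are at distance 2 |x ∪ y|.  Ramsey's theorem gives
-- encodings such that every query sees only x ∪ y; applied once more, it gives a
-- t-element subset of [s] on which every query is constant on the unions of size
-- t - 1.  Some query must distinguish these from the unions of size t.  If x
-- ranges over the complements of singletons {a}, and y over all subsets, then
-- |x ∪ y| = t if a ∈ y, and t - 1 otherwise: the query contains the index matrix.

open import Data.Product using (∃-syntax; _×_)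
open import Relation.Nullary using (¬_)
open import Defs

-- Ramsey's theorem for colourings of the `u`-element subsets of a finite set.

module Ramsey where

  open import Data.Bool using (Bool; true; false)
  open import Data.List using (List; []; _∷_; length; map)
  open import Data.List.Properties using (length-map)
  open import Data.List.Relation.Unary.All as All using (All; []; _∷_)
  import Data.List.Relation.Unary.All.Properties as All
  open import Data.Nat using (ℕ; zero; suc; _+_; _≤_; z≤n; s≤s⁻¹)
  open import Data.Nat.Properties using (suc-injective)
  open import Data.Product using (_,_; proj₁; proj₂)
  open import Data.Sum as Sum using (_⊎_; inj₁; inj₂)
  open import Data.Vec using (Vec; []; _∷_; replicate)
  open import Function using (_∘_)
  open import Relation.Binary.PropositionalEquality

  weight : ∀ {n} → Vec Bool n → ℕ
  weight []          = 0
  weight (true ∷ v)  = suc (weight v)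
  weight (false ∷ v) = weight v

  -- Order embeddings of Fin m into Fin n, acting on subsets by direct image.
  data Thinning : ℕ → ℕ → Set where
    done : Thinning 0 0
    keep : ∀ {m n} → Thinning m n → Thinning (suc m) (suc n)
    skip : ∀ {m n} → Thinning m n → Thinning m (suc n)

  image : ∀ {m n} → Thinning m n → Vec Bool m → Vec Bool n
  image done     []      = []
  image (keep ι) (b ∷ v) = b ∷ image ι v
  image (skip ι) v       = false ∷ image ι v

  idₜ : ∀ n → Thinning n n
  idₜ zero    = done
  idₜ (suc n) = keep (idₜ n)

  image-idₜ : ∀ {n} (v : Vec Bool n) → image (idₜ n) v ≡ v
  image-idₜ []      = refl
  image-idₜ (b ∷ v) = cong (b ∷_) (image-idₜ v)

  _∘ₜ_ : ∀ {l m n} → Thinning m n → Thinning l m → Thinning l n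
  done   ∘ₜ ι      = ι
  keep κ ∘ₜ keep ι = keep (κ ∘ₜ ι)
  keep κ ∘ₜ skip ι = skip (κ ∘ₜ ι)
  skip κ ∘ₜ ι      = skip (κ ∘ₜ ι)

  image-∘ₜ : ∀ {l m n} (κ : Thinning m n) (ι : Thinning l m) v →
             image (κ ∘ₜ ι) v ≡ image κ (image ι v)
  image-∘ₜ done     done     []      = refl
  image-∘ₜ (keep κ) (keep ι) (b ∷ v) = cong (b ∷_) (image-∘ₜ κ ι v)
  image-∘ₜ (keep κ) (skip ι) v       = cong (false ∷_) (image-∘ₜ κ ι v)
  image-∘ₜ (skip κ) ι        v       = cong (false ∷_) (image-∘ₜ κ ι v)

  empty : ∀ n → Thinning 0 n
  empty zero    = done
  empty (suc n) = skip (empty n)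

  leftₜ : ∀ m n → Thinning m (m + n)
  leftₜ zero    n = empty n
  leftₜ (suc m) n = keep (leftₜ m n)

  rightₜ : ∀ m n → Thinning n (m + n)
  rightₜ zero    n = idₜ n
  rightₜ (suc m) n = skip (rightₜ m n)

  weight-image : ∀ {m n} (ι : Thinning m n) v → weight (image ι v) ≡ weight v
  weight-image done     []          = refl
  weight-image (keep ι) (true ∷ v)  = cong suc (weight-image ι v)
  weight-image (keep ι) (false ∷ v) = weight-image ι v
  weight-image (skip ι) v           = weight-image ι v

  weight≡0 : ∀ {n} (v : Vec Bool n) → weight v ≡ 0 → v ≡ replicate n false
  weight≡0 []          _ = refl
  weight≡0 (false ∷ v) p = cong (false ∷_) (weight≡0 v p)

  Coloured : ℕ → ∀ {n} → Bool → (Vec Bool n → Bool) → Set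
  Coloured u κ f = ∀ D → weight D ≡ u → f D ≡ κ

  Homogeneous : ℕ → ∀ {n} → (Vec Bool n → Bool) → Set
  Homogeneous u f = ∀ D D′ → weight D ≡ u → weight D′ ≡ u → f D ≡ f D′

  coloured-∘ : ∀ {u m n κ} {f : Vec Bool n → Bool} (ι : Thinning m n) →
               Coloured u κ f → Coloured u κ (f ∘ image ι)
  coloured-∘ ι h D p = h (image ι D) (trans (weight-image ι D) p)

  coloured-∘ₜ : ∀ {u l m n κ} {f : Vec Bool n → Bool} (ι : Thinning m n) (ι′ : Thinning l m) →
                Coloured u κ (f ∘ image ι ∘ image ι′) → Coloured u κ (f ∘ image (ι ∘ₜ ι′))
  coloured-∘ₜ {f = f} ι ι′ h D p = trans (cong f (image-∘ₜ ι ι′ D)) (h D p)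

  coloured-keep : ∀ {u m n κ} {f : Vec Bool (suc n) → Bool} (ι : Thinning m n) →
                  Coloured u κ (f ∘ (true ∷_) ∘ image ι) →
                  Coloured (suc u) κ (f ∘ (false ∷_) ∘ image ι) →
                  Coloured (suc u) κ (f ∘ image (keep ι))
  coloured-keep ι h₁ h₀ (true ∷ D)  p = h₁ D (suc-injective p)
  coloured-keep ι h₁ h₀ (false ∷ D) p = h₀ D p

  -- The off-diagonal form, with separate target sizes for the two colours, because the induction
  -- lowers one of them at a time.
  Ramsey₂ : ℕ → ℕ → ℕ → Set
  Ramsey₂ u a b = ∃[ N ] ∀ (f : Vec Bool N → Bool) →
    (∃[ ι ] Coloured u true (f ∘ image {a} ι)) ⊎ (∃[ ι ] Coloured u false (f ∘ image {b} ι))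

  Ramsey₁ : ℕ → ℕ → Set
  Ramsey₁ u n = ∃[ N ] ∀ (f : Vec Bool N → Bool) →
    ∃[ κ ] ∃[ ι ] Coloured u κ (f ∘ image {n} ι)

  coloured-trivial : ∀ {u κ} {f : Vec Bool 0 → Bool} → Coloured (suc u) κ f
  coloured-trivial [] ()

  HasColoured : ℕ → ∀ {N} → ℕ → Bool → (Vec Bool N → Bool) → Set
  HasColoured u n κ f = ∃[ ι ] Coloured u κ (f ∘ image {n} ι)

  coloured-restrict : ∀ {u l m n κ} {f : Vec Bool n → Bool} (ι : Thinning m n) (ι′ : Thinning l m) →
                      Coloured u κ (f ∘ image ι) → Coloured u κ (f ∘ image (ι ∘ₜ ι′))
  coloured-restrict {f = f} ι ι′ h = coloured-∘ₜ {f = f} ι ι′ (coloured-∘ {f = f ∘ image ι} ι′ h)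

  -- A colour class of the sets avoiding the first element, shrunk to lie in a
  -- class for the sets containing it, can be extended by the first element.
  coloured-extend : ∀ {u n m N κ} {f : Vec Bool (suc N) → Bool} (ι : Thinning m N) →
                    Coloured u κ (f ∘ (true ∷_) ∘ image ι) →
                    HasColoured (suc u) n κ (f ∘ (false ∷_) ∘ image ι) →
                    HasColoured (suc u) (suc n) κ f
  coloured-extend {f = f} ι h (ι′ , h′) =
    keep (ι ∘ₜ ι′) ,
    coloured-keep {f = f} (ι ∘ₜ ι′)
      (coloured-restrict {f = f ∘ (true ∷_)} ι ι′ h)
      (coloured-∘ₜ {f = f ∘ (false ∷_)} ι ι′ h′)

  coloured-skip : ∀ {u n m N κ} {f : Vec Bool (suc N) → Bool} (ι : Thinning m N) →
                  HasColoured u n κ (f ∘ (false ∷_) ∘ image ι) → HasColoured u n κ f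
  coloured-skip {f = f} ι (ι′ , h′) =
    skip (ι ∘ₜ ι′) , coloured-∘ₜ {f = f ∘ (false ∷_)} ι ι′ h′

  -- The sets through the first element induce a colouring of the `u`-subsets of the rest, which is
  -- made constant on `m + n` points. If that colour is `true`, `m` of these points suffice for the
  -- sizes `a` and `suc b`, and the first element extends a `true` set of size `a`. The colour
  -- `false` is symmetric and uses the other `n` points.
  ramsey₂-step : ∀ {u a b} → (∀ n → Ramsey₁ u n) →
                 Ramsey₂ (suc u) a (suc b) → Ramsey₂ (suc u) (suc a) b →
                 Ramsey₂ (suc u) (suc a) (suc b)
  ramsey₂-step {u} {a} {b} ramsey (m , r) (n , s) with ramsey (m + n)
  ... | N , t = suc N , λ f → split f (t (f ∘ (true ∷_)))
    where
    split : (f : Vec Bool (suc N) → Bool) →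
            ∃[ κ ] HasColoured u (m + n) κ (f ∘ (true ∷_)) →
            HasColoured (suc u) (suc a) true f ⊎ HasColoured (suc u) (suc b) false f
    split f (true , ι , h) =
      Sum.map (coloured-extend {f = f} ι′ (coloured-restrict {f = f ∘ (true ∷_)} ι (leftₜ m n) h))
              (coloured-skip {f = f} ι′)
              (r (f ∘ (false ∷_) ∘ image ι′))
      where ι′ = ι ∘ₜ leftₜ m n
    split f (false , ι , h) =
      Sum.map (coloured-skip {f = f} ι′)
              (coloured-extend {f = f} ι′ (coloured-restrict {f = f ∘ (true ∷_)} ι (rightₜ m n) h))
              (s (f ∘ (false ∷_) ∘ image ι′))
      where ι′ = ι ∘ₜ rightₜ m n

  ramsey₂ : ∀ {u} → (∀ n → Ramsey₁ u n) → ∀ a b → Ramsey₂ (suc u) a b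
  -- A set with no points has no subsets of size `suc u`, so any colour fits vacuously.
  ramsey₂ ramsey zero    b       = 0 , λ f → inj₁ (done , coloured-trivial {f = f ∘ image done})
  ramsey₂ ramsey (suc a) zero    = 0 , λ f → inj₂ (done , coloured-trivial {f = f ∘ image done})
  ramsey₂ ramsey (suc a) (suc b) =
    ramsey₂-step ramsey (ramsey₂ ramsey a (suc b)) (ramsey₂ ramsey (suc a) b)

  ramsey₁ : ∀ u n → Ramsey₁ u n
  ramsey₁ zero n = n , λ f → f (replicate n false) , idₜ n ,
    λ D p → cong f (trans (image-idₜ D) (weight≡0 D p))
  ramsey₁ (suc u) n with ramsey₂ (ramsey₁ u) n n
  ... | N , r = N , λ f → Sum.[ true ,_ , false ,_ ] (r f)

  Ramsey : ℕ → ℕ → ℕ → Set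
  Ramsey K u n = ∃[ N ] ∀ (fs : List (Vec Bool N → Bool)) → length fs ≤ K →
    ∃[ ι ] All (λ f → Homogeneous u (f ∘ image {n} ι)) fs

  -- The colourings are treated in turn: `ramsey₁` makes the first one constant on `M` points, the
  -- induction hypothesis shrinks these for the others, and constancy survives passing to a subset.
  ramsey : ∀ K u n → Ramsey K u n
  ramsey zero u n = n , λ { [] _ → idₜ n , [] }
  ramsey (suc K) u n with ramsey K u n
  ... | M , r with ramsey₁ u M
  ... | N , s = N , go
    where
    go : (fs : List (Vec Bool N → Bool)) → length fs ≤ suc K →
         ∃[ ι ] All (λ f → Homogeneous u (f ∘ image {n} ι)) fs
    -- There is no colouring left, but an embedding is still owed; a dummy colouring provides its
    -- outer half.
    go [] _ = proj₁ (proj₂ (s (λ _ → true))) ∘ₜ proj₁ (r [] z≤n) , []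
    go (f ∷ fs) p with s f
    ... | κ , ι , h with r (map (λ g → g ∘ image ι) fs)
                           (subst (_≤ K) (sym (length-map _ fs)) (s≤s⁻¹ p))
    ... | ι′ , hs = ι ∘ₜ ι′ ,
      (λ D D′ p q → trans (h″ D p) (sym (h″ D′ q))) ∷
      All.map (λ {g} h D D′ p q →
                 trans (cong g (image-∘ₜ ι ι′ D))
                       (trans (h D D′ p q) (cong g (sym (image-∘ₜ ι ι′ D′)))))
              (All.map⁻ hs)
      where h″ = coloured-restrict {f = f} ι ι′ h

-- Enumeration of all vectors over a finite list.

module Enumeration where

  open import Data.Bool using (Bool; true; false)
  open import Data.List using (List; []; _∷_; length; map; cartesianProductWith)
  open import Data.List.Membership.Propositional using (_∈_)
  open import Data.List.Membership.Propositional.Properties using (∈-cartesianProductWith⁺)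
  open import Data.List.Properties using (length-map; length-++)
  open import Data.List.Relation.Unary.Any using (here; there)
  open import Data.Nat using (zero; suc; _+_; _*_)
  open import Data.Vec using (Vec; []; _∷_)
  open import Relation.Binary.PropositionalEquality

  -- The head varies fastest, so a sum over these vectors unfolds into a sum over tails of sums over
  -- heads, the shape used by the later inductions on the length.
  vectors : {A : Set} → List A → ∀ n → List (Vec A n)
  vectors as zero    = [] ∷ []
  vectors as (suc n) = cartesianProductWith (λ v a → a ∷ v) (vectors as n) as

  bools : List Bool
  bools = false ∷ true ∷ []

  length-cartesianProductWith : {A B C : Set} (f : A → B → C) (xs : List A) (ys : List B) →
    length (cartesianProductWith f xs ys) ≡ length xs * length ys
  length-cartesianProductWith f []       ys = refl
  length-cartesianProductWith f (x ∷ xs) ys =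
    trans (length-++ (map (f x) ys))
          (cong₂ _+_ (length-map (f x) ys) (length-cartesianProductWith f xs ys))

  ∈-bools : ∀ b → b ∈ bools
  ∈-bools false = here refl
  ∈-bools true  = there (here refl)

  ∈-vectors : ∀ {n} (v : Vec Bool n) → v ∈ vectors bools n
  ∈-vectors []      = here refl
  ∈-vectors (b ∷ v) = ∈-cartesianProductWith⁺ (λ v a → a ∷ v) (∈-vectors v) (∈-bools b)


-- Embedding of the subset cube on which queries see only unions.

module CubeEmbedding where

  open import Data.Bool using (Bool; true; false; not; _∨_; _xor_)
  open import Data.List using (List; length; map; cartesianProductWith)
  open import Data.List.Membership.Propositional using (_∈_)
  open import Data.List.Membership.Propositional.Properties
    using (∈-cartesianProductWith⁺; ∈-map⁺)
  open import Data.List.Properties using (length-map)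
  open import Data.List.Relation.Unary.All as All using ()
  open import Data.Nat using (ℕ; suc; _+_; _*_; _≤_)
  open import Data.Nat.Properties using (*-monoˡ-≤)
  open import Data.Product using (_,_)
  open import Data.Vec using (Vec; []; _∷_; zipWith; replicate)
  open import Function using (_∘_)
  open import Relation.Binary.PropositionalEquality
  open Enumeration
  open Ramsey

  _∪_ : ∀ {n} → Vec Bool n → Vec Bool n → Vec Bool n
  _∪_ = zipWith _∨_

  _⊕_ : ∀ {n} → Vec Bool n → Vec Bool n → Vec Bool n
  _⊕_ = zipWith _xor_

  distance : ∀ {n} → Vec Bool n → Vec Bool n → ℕ
  distance v w = weight (v ⊕ w)

  distance-image : ∀ {m n} (ι : Thinning m n) v w →
                   distance (image ι v) (image ι w) ≡ distance v w
  distance-image done     []          []          = refl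
  distance-image (keep ι) (true ∷ v)  (true ∷ w)  = distance-image ι v w
  distance-image (keep ι) (true ∷ v)  (false ∷ w) = cong suc (distance-image ι v w)
  distance-image (keep ι) (false ∷ v) (true ∷ w)  = cong suc (distance-image ι v w)
  distance-image (keep ι) (false ∷ v) (false ∷ w) = distance-image ι v w
  distance-image (skip ι) v           w           = distance-image ι v w

  image-∪ : ∀ {m n} (ι : Thinning m n) v w → image ι v ∪ image ι w ≡ image ι (v ∪ w)
  image-∪ done     []      []      = refl
  image-∪ (keep ι) (b ∷ v) (c ∷ w) = cong ((b ∨ c) ∷_) (image-∪ ι v w)
  image-∪ (skip ι) v       w       = cong (false ∷_) (image-∪ ι v w)

  -- Splits the elements of Z into consecutive pairs and picks from the i-th pair
  -- the smaller or the larger element according to the i-th bit.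
  mutual
    pick : ∀ {s n} → Vec Bool s → Vec Bool n → Vec Bool n
    pick ds       []          = []
    pick ds       (false ∷ Z) = false ∷ pick ds Z
    pick []       (true ∷ Z)  = false ∷ pick [] Z
    pick (d ∷ ds) (true ∷ Z)  = not d ∷ pickSecond d ds Z

    pickSecond : ∀ {s n} → Bool → Vec Bool s → Vec Bool n → Vec Bool n
    pickSecond d ds []          = []
    pickSecond d ds (false ∷ Z) = false ∷ pickSecond d ds Z
    pickSecond d ds (true ∷ Z)  = d ∷ pick ds Z

  mutual
    -- An order embedding preserves the pairing and which element of a pair is the smaller.
    pick-image : ∀ {s m n} (ds : Vec Bool s) (ι : Thinning m n) Z →
                 pick ds (image ι Z) ≡ image ι (pick ds Z)
    pick-image ds       done     []          = refl
    pick-image ds       (skip ι) Z           = cong (false ∷_) (pick-image ds ι Z)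
    pick-image ds       (keep ι) (false ∷ Z) = cong (false ∷_) (pick-image ds ι Z)
    pick-image []       (keep ι) (true ∷ Z)  = cong (false ∷_) (pick-image [] ι Z)
    pick-image (d ∷ ds) (keep ι) (true ∷ Z)  = cong (not d ∷_) (pickSecond-image d ds ι Z)

    pickSecond-image : ∀ {s m n} d (ds : Vec Bool s) (ι : Thinning m n) Z →
                       pickSecond d ds (image ι Z) ≡ image ι (pickSecond d ds Z)
    pickSecond-image d ds done     []          = refl
    pickSecond-image d ds (skip ι) Z           = cong (false ∷_) (pickSecond-image d ds ι Z)
    pickSecond-image d ds (keep ι) (false ∷ Z) = cong (false ∷_) (pickSecond-image d ds ι Z)
    pickSecond-image d ds (keep ι) (true ∷ Z)  = cong (d ∷_) (pick-image ds ι Z)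

  -- Each block has elements q < p < r.  A row contains p or, on x, q; a column
  -- contains p or, on y, r.  The pair set of the block contains both of them.
  rowBlocks : ∀ {s} → Vec Bool s → Vec Bool (s * 3)
  rowBlocks []          = []
  rowBlocks (false ∷ x) = false ∷ true ∷ false ∷ rowBlocks x
  rowBlocks (true ∷ x)  = true ∷ false ∷ false ∷ rowBlocks x

  columnBlocks : ∀ {s} → Vec Bool s → Vec Bool (s * 3)
  columnBlocks []          = []
  columnBlocks (false ∷ y) = false ∷ true ∷ false ∷ columnBlocks y
  columnBlocks (true ∷ y)  = false ∷ false ∷ true ∷ columnBlocks y

  pairBlocks : ∀ {s} → Vec Bool s → Vec Bool s → Vec Bool (s * 3)
  pairBlocks []          []          = []
  pairBlocks (false ∷ x) (b ∷ y)     = false ∷ true ∷ true ∷ pairBlocks x y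
  pairBlocks (true ∷ x)  (false ∷ y) = true ∷ true ∷ false ∷ pairBlocks x y
  pairBlocks (true ∷ x)  (true ∷ y)  = true ∷ false ∷ true ∷ pairBlocks x y

  weight-pairBlocks : ∀ {s} (x y : Vec Bool s) → weight (pairBlocks x y) ≡ s * 2
  weight-pairBlocks []          []          = refl
  weight-pairBlocks (false ∷ x) (b ∷ y)     = cong (2 +_) (weight-pairBlocks x y)
  weight-pairBlocks (true ∷ x)  (false ∷ y) = cong (2 +_) (weight-pairBlocks x y)
  weight-pairBlocks (true ∷ x)  (true ∷ y)  = cong (2 +_) (weight-pairBlocks x y)

  -- In every block the row element is the smaller one of the pair set, so the all-`false` mask
  -- recovers the row for every `y`.
  pick-rowBlocks : ∀ {s} (x y : Vec Bool s) →
                   pick (replicate s false) (pairBlocks x y) ≡ rowBlocks x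
  pick-rowBlocks []          []          = refl
  pick-rowBlocks (false ∷ x) (b ∷ y) =
    cong (λ v → false ∷ true ∷ false ∷ v) (pick-rowBlocks x y)
  pick-rowBlocks (true ∷ x)  (false ∷ y) =
    cong (λ v → true ∷ false ∷ false ∷ v) (pick-rowBlocks x y)
  pick-rowBlocks (true ∷ x)  (true ∷ y) =
    cong (λ v → true ∷ false ∷ false ∷ v) (pick-rowBlocks x y)

  -- The column element is the larger one of its pair, except in blocks belonging to neither `x` nor
  -- `y`: there row and column share `p`, and `r` only completes the pair. Hence the mask is exactly
  -- `x ∪ y`.
  pick-columnBlocks : ∀ {s} (x y : Vec Bool s) → pick (x ∪ y) (pairBlocks x y) ≡ columnBlocks y
  pick-columnBlocks []          []          = refl
  pick-columnBlocks (false ∷ x) (false ∷ y) =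
    cong (λ v → false ∷ true ∷ false ∷ v) (pick-columnBlocks x y)
  pick-columnBlocks (false ∷ x) (true ∷ y) =
    cong (λ v → false ∷ false ∷ true ∷ v) (pick-columnBlocks x y)
  pick-columnBlocks (true ∷ x)  (false ∷ y) =
    cong (λ v → false ∷ true ∷ false ∷ v) (pick-columnBlocks x y)
  pick-columnBlocks (true ∷ x)  (true ∷ y) =
    cong (λ v → false ∷ false ∷ true ∷ v) (pick-columnBlocks x y)

  -- Row and column share `p` in the blocks outside the union; in every other block they hold two
  -- different elements, which contributes 2.
  distance-blocks : ∀ {s} (x y : Vec Bool s) →
                    distance (rowBlocks x) (columnBlocks y) ≡ weight (x ∪ y) * 2
  distance-blocks []          []          = refl
  distance-blocks (false ∷ x) (false ∷ y) = distance-blocks x y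
  distance-blocks (false ∷ x) (true ∷ y)  = cong (2 +_) (distance-blocks x y)
  distance-blocks (true ∷ x)  (false ∷ y) = cong (2 +_) (distance-blocks x y)
  distance-blocks (true ∷ x)  (true ∷ y)  = cong (2 +_) (distance-blocks x y)

  record Embedding (u n M : ℕ) (Qs : List (Vec Bool M → Vec Bool M → Bool)) : Set where
    field
      row column : Vec Bool n → Vec Bool M
      distance-embedded : ∀ x y → distance (row x) (column y) ≡ weight (x ∪ y) * 2
      invariant : ∀ {Q} → Q ∈ Qs → ∀ x y x′ y′ → x ∪ y ≡ x′ ∪ y′ → 
        Q (row x) (column y) ≡ Q (row x′) (column y′)
      homogeneous : ∀ {Q} → Q ∈ Qs → ∀ x y x′ y′ → weight (x ∪ y) ≡ u → weight (x′ ∪ y′) ≡ u →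
        Q (row x) (column y) ≡ Q (row x′) (column y′)

  -- Two applications of `ramsey`, the inner size `s` being chosen first. On `M` points, one
  -- colouring of the pair sets for each query and mask makes the value of a query depend on the
  -- mask alone, that is on the union. On `s` points, one colouring per query makes this value
  -- constant on masks of weight `u`.
  embedding : ∀ K u n → ∃[ M ] ∀ (Qs : List (Vec Bool M → Vec Bool M → Bool)) →
              length Qs ≤ K → Embedding u n M Qs
  embedding K u n with ramsey K u n
  ... | s , r₂ with ramsey (K * length (vectors bools s)) (s * 2) (s * 3)
  ... | M , r₁ = M , embed
    where
    Query : Set
    Query = Vec Bool M → Vec Bool M → Bool

    pairColour : Query → Vec Bool s → Vec Bool M → Bool
    pairColour Q D Z = Q (pick (replicate s false) Z) (pick D Z)

    -- Inside a homogeneous set every pair set of weight `s * 2` gives the same colour;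
    -- `pairBlocks D D` is a choice expressed through the mask alone.
    maskColour : Thinning (s * 3) M → Query → Vec Bool s → Bool
    maskColour ι Q D = pairColour Q D (image ι (pairBlocks D D))

    embed : (Qs : List Query) → length Qs ≤ K → Embedding u n M Qs
    embed Qs Qs≤K
      with r₁ (cartesianProductWith pairColour Qs (vectors bools s))
              (subst (_≤ K * _) (sym (length-cartesianProductWith pairColour Qs _))
                     (*-monoˡ-≤ _ Qs≤K))
    ... | ι₁ , hom₁
      with r₂ (map (maskColour ι₁) Qs)
              (subst (_≤ K) (sym (length-map (maskColour ι₁) Qs)) Qs≤K)
    ... | ι₂ , hom₂ = record
      { row               = row
      ; column            = column
      ; distance-embedded = λ x y →
          trans (distance-image ι₁ _ _)
            (trans (distance-blocks (image ι₂ x) (image ι₂ y))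
              (cong (_* 2) (trans (cong weight (image-∪ ι₂ x y)) (weight-image ι₂ _))))
      ; invariant         = λ {Q} Q∈Qs x y x′ y′ e →
          trans (colour Q∈Qs x y)
            (trans (cong (maskColour ι₁ Q ∘ image ι₂) e) (sym (colour Q∈Qs x′ y′)))
      ; homogeneous       = λ {Q} Q∈Qs x y x′ y′ e e′ →
          trans (colour Q∈Qs x y)
            (trans (All.lookup hom₂ (∈-map⁺ (maskColour ι₁) Q∈Qs) _ _ e e′)
              (sym (colour Q∈Qs x′ y′)))
      }
      where
      row column : Vec Bool n → Vec Bool M
      row x    = image ι₁ (rowBlocks (image ι₂ x))
      column y = image ι₁ (columnBlocks (image ι₂ y))

      colour : ∀ {Q} → Q ∈ Qs → ∀ x y →
               Q (row x) (column y) ≡ maskColour ι₁ Q (image ι₂ (x ∪ y))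
      colour {Q} Q∈Qs x y = begin
        Q (image ι₁ (rowBlocks X)) (image ι₁ (columnBlocks Y))
          ≡⟨ cong₂ (λ v w → Q (image ι₁ v) (image ι₁ w))
                   (pick-rowBlocks X Y) (pick-columnBlocks X Y) ⟨
        Q (image ι₁ (pick (replicate s false) (pairBlocks X Y)))
          (image ι₁ (pick (X ∪ Y) (pairBlocks X Y)))
          ≡⟨ cong₂ Q (pick-image _ ι₁ (pairBlocks X Y)) (pick-image (X ∪ Y) ι₁ (pairBlocks X Y)) ⟨
        pairColour Q (X ∪ Y) (image ι₁ (pairBlocks X Y))
          ≡⟨ All.lookup hom₁ (∈-cartesianProductWith⁺ pairColour Q∈Qs (∈-vectors (X ∪ Y))) _ _
               (weight-pairBlocks X Y) (weight-pairBlocks (X ∪ Y) (X ∪ Y)) ⟩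
        maskColour ι₁ Q (X ∪ Y)
          ≡⟨ cong (maskColour ι₁ Q) (image-∪ ι₂ x y) ⟩
        maskColour ι₁ Q (image ι₂ (x ∪ y)) ∎
        where
        open ≡-Reasoning
        X = image ι₂ x
        Y = image ι₂ y

-- Finite sums of integers.

module Summation where

  open import Data.Bool using (Bool; true; false)
  open import Data.Fin using (Fin; zero; suc)
  open import Data.Integer using (ℤ; +_; _+_; _*_; _≤_; 0ℤ; 1ℤ)
  open import Data.Integer.Properties
  open import Data.Integer.Tactic.RingSolver using (solve-∀)
  open import Data.List using (List; []; _∷_; _++_; length; map; cartesianProductWith; allFin)
  import Data.List as List
  open import Data.List.Properties using (map-tabulate)
  open import Data.Nat as ℕ using (ℕ; zero; suc)
  import Data.Nat.Properties as ℕ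
  open import Function using (_∘_; id)
  open import Relation.Binary.PropositionalEquality
  open Enumeration

  private variable
    A B C : Set

  ∑ : List A → (A → ℤ) → ℤ
  ∑ []       f = 0ℤ
  ∑ (x ∷ xs) f = f x + ∑ xs f

  ∑-cong : ∀ (xs : List A) {f g : A → ℤ} → (∀ x → f x ≡ g x) → ∑ xs f ≡ ∑ xs g
  ∑-cong []       f≡g = refl
  ∑-cong (x ∷ xs) f≡g = cong₂ _+_ (f≡g x) (∑-cong xs f≡g)

  ∑-mono : ∀ (xs : List A) {f g : A → ℤ} → (∀ x → f x ≤ g x) → ∑ xs f ≤ ∑ xs g
  ∑-mono []       f≤g = ≤-refl
  ∑-mono (x ∷ xs) f≤g = +-mono-≤ (f≤g x) (∑-mono xs f≤g)

  ∑-+ : ∀ (xs : List A) (f g : A → ℤ) → ∑ xs (λ x → f x + g x) ≡ ∑ xs f + ∑ xs g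
  ∑-+ []       f g = refl
  ∑-+ (x ∷ xs) f g =
    trans (cong (_+_ (f x + g x)) (∑-+ xs f g)) (lemma (f x) (g x) (∑ xs f) (∑ xs g))
    where
    lemma : ∀ a b c d → a + b + (c + d) ≡ a + c + (b + d)
    lemma = solve-∀

  ∑-* : ∀ (xs : List A) c (f : A → ℤ) → ∑ xs (λ x → c * f x) ≡ c * ∑ xs f
  ∑-* []       c f = sym (*-zeroʳ c)
  ∑-* (x ∷ xs) c f = trans (cong (_+_ (c * f x)) (∑-* xs c f)) (sym (*-distribˡ-+ c (f x) (∑ xs f)))

  ∑-const : ∀ (xs : List A) c → ∑ xs (λ _ → c) ≡ + length xs * c
  ∑-const []       c = refl
  ∑-const (x ∷ xs) c = trans (cong (_+_ c) (∑-const xs c)) (lemma c (+ length xs))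
    where
    lemma : ∀ c n → c + n * c ≡ (1ℤ + n) * c
    lemma = solve-∀

  ∑-swap : ∀ (xs : List A) (ys : List B) (f : A → B → ℤ) →
           ∑ xs (λ x → ∑ ys (f x)) ≡ ∑ ys (λ y → ∑ xs (λ x → f x y))
  ∑-swap []       ys f = sym (trans (∑-const ys 0ℤ) (*-zeroʳ (+ length ys)))
  ∑-swap (x ∷ xs) ys f =
    trans (cong (_+_ (∑ ys (f x))) (∑-swap xs ys f)) (sym (∑-+ ys (f x) _))

  ∑-++ : ∀ (xs ys : List A) (f : A → ℤ) → ∑ (xs ++ ys) f ≡ ∑ xs f + ∑ ys f
  ∑-++ []       ys f = sym (+-identityˡ _)
  ∑-++ (x ∷ xs) ys f = trans (cong (_+_ (f x)) (∑-++ xs ys f)) (sym (+-assoc (f x) _ _))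

  ∑-map : ∀ (xs : List A) (g : A → B) (f : B → ℤ) → ∑ (map g xs) f ≡ ∑ xs (f ∘ g)
  ∑-map []       g f = refl
  ∑-map (x ∷ xs) g f = cong (_+_ (f (g x))) (∑-map xs g f)

  ∑-cartesianProductWith : ∀ (g : A → B → C) xs ys (f : C → ℤ) →
    ∑ (cartesianProductWith g xs ys) f ≡ ∑ xs (λ x → ∑ ys (λ y → f (g x y)))
  ∑-cartesianProductWith g []       ys f = refl
  ∑-cartesianProductWith g (x ∷ xs) ys f =
    trans (∑-++ (map (g x) ys) _ f)
          (cong₂ _+_ (∑-map ys (g x) f) (∑-cartesianProductWith g xs ys f))

  ∑-allFin : ∀ {n} (f : Fin (suc n) → ℤ) → ∑ (allFin (suc n)) f ≡ f zero + ∑ (allFin n) (f ∘ suc)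
  ∑-allFin {n} f = cong (_+_ (f zero))
    (trans (cong (λ xs → ∑ xs f) (sym (map-tabulate id suc))) (∑-map (allFin n) suc f))

  length-vectors : ∀ (as : List A) n → length (vectors as n) ≡ length as ℕ.^ n
  length-vectors as zero    = refl
  length-vectors as (suc n) =
    trans (length-cartesianProductWith _ (vectors as n) as)
          (trans (cong (ℕ._* length as) (length-vectors as n)) (ℕ.*-comm _ (length as)))

  ∑-lookup : ∀ (xs : List A) (f : A → ℤ) → ∑ (allFin (length xs)) (f ∘ List.lookup xs) ≡ ∑ xs f
  ∑-lookup []       f = refl
  ∑-lookup (x ∷ xs) f =
    trans (∑-allFin (f ∘ List.lookup (x ∷ xs))) (cong (_+_ (f x)) (∑-lookup xs f))

  ⟦_⟧ : Bool → ℤ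
  ⟦ true ⟧  = 1ℤ
  ⟦ false ⟧ = 0ℤ


-- Success probabilities as integer inequalities.

module Probability where

  open import Data.Bool using (true; false; if_then_else_)
  open import Data.Fin using (Fin; zero; suc)
  open import Data.Integer using (+_; _+_; _*_; _≤_)
  open import Data.Integer.Properties using (*-comm)
  open import Data.List using (allFin)
  open import Data.Nat as ℕ using (ℕ; zero; suc)
  open import Data.Rational as ℚ using ()
  open import Data.Rational.Properties using (toℚᵘ-fromℚᵘ; toℚᵘ-mono-≤; toℚᵘ-cancel-≤)
  open import Data.Rational.Unnormalised using (mkℚᵘ; *≤*)
  import Data.Rational.Unnormalised.Properties as ℚᵘ
  open import Data.Vec as Vec using ()
  open import Function using (_∘_; id)
  open import Level using (0ℓ)
  open import Relation.Nullary using (Dec; does)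
  open import Relation.Unary using (Pred; Decidable)
  open import Relation.Binary.PropositionalEquality
  open Summation

  -- Since `ℚ./` reduces to lowest terms, the cross-multiplied inequality is read off the equivalent
  -- unnormalised fraction.
  /≥2/3⇒ : ∀ k s .{{_ : ℕ.NonZero s}} → + k ℚ./ s ℚ.≥ + 2 ℚ./ 3 → + 2 * + s ≤ + 3 * + k
  /≥2/3⇒ k (suc d) p
    with *≤* q ← ℚᵘ.≤-respˡ-≃ (toℚᵘ-fromℚᵘ (mkℚᵘ (+ 2) 2))
                  (ℚᵘ.≤-respʳ-≃ (toℚᵘ-fromℚᵘ (mkℚᵘ (+ k) d)) (toℚᵘ-mono-≤ p))
    = subst (+ 2 * + suc d ≤_) (*-comm (+ k) (+ 3)) q

  ⇒/≥2/3 : ∀ k s .{{_ : ℕ.NonZero s}} → + 2 * + s ≤ + 3 * + k → + k ℚ./ s ℚ.≥ + 2 ℚ./ 3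
  ⇒/≥2/3 k (suc d) p = toℚᵘ-cancel-≤
    (ℚᵘ.≤-respˡ-≃ (ℚᵘ.≃-sym (toℚᵘ-fromℚᵘ (mkℚᵘ (+ 2) 2)))
      (ℚᵘ.≤-respʳ-≃ (ℚᵘ.≃-sym (toℚᵘ-fromℚᵘ (mkℚᵘ (+ k) d)))
        (*≤* (subst (+ 2 * + suc d ≤_) (*-comm (+ 3) (+ k)) p))))

  -- Stated for a tabulated `f` so that the induction can pass to `f ∘ suc`; the tail of `allFin` is
  -- not itself an `allFin`.
  count≡∑ : ∀ {A : Set} {n} {P : Pred A 0ℓ} (P? : Decidable P) (f : Fin n → A) →
            + Vec.count P? (Vec.tabulate f) ≡ ∑ (allFin n) (λ i → ⟦ does (P? (f i)) ⟧)
  count≡∑ {n = zero}  P? f = refl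
  count≡∑ {n = suc n} P? f =
    trans (head (P? (f zero)) (Vec.count P? (Vec.tabulate (f ∘ suc))))
      (trans (cong (_+_ ⟦ does (P? (f zero)) ⟧) (count≡∑ P? (f ∘ suc)))
             (sym (∑-allFin (λ i → ⟦ does (P? (f i)) ⟧))))
    where
    head : ∀ {P : Set} (P? : Dec P) k → + ((if does P? then suc else id) k) ≡ ⟦ does P? ⟧ + + k
    head P? k with does P?
    ... | true  = refl
    ... | false = refl


-- Randomized lower bound for the index matrix.

module IndexMatrix where

  open import Data.Bool using (Bool; true; false; if_then_else_; not; _∧_; _xor_)
  open import Data.Bool.Properties using () renaming (_≟_ to _≟ᵇ_)
  open import Data.Fin using (Fin; zero; suc)
  open import Data.Integer
    using (ℤ; +_; -[1+_]; -_; _+_; _*_; _-_; _≤_; 0ℤ; 1ℤ; -1ℤ; +≤+; +<+; Positive; positive)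
  open import Data.Integer.Properties
  open import Data.Integer.Tactic.RingSolver using (solve-∀)
  open import Data.List using (length; allFin)
  open import Data.List.Properties using (length-tabulate)
  open import Data.Nat as ℕ using (ℕ; zero; suc; z≤n; s≤s)
  import Data.Nat.Properties as ℕ
  open import Data.Product using (Σ-syntax; _,_)
  open import Data.Rational as ℚ using ()
  open import Data.Vec as Vec using (Vec; _∷_; lookup)
  open import Function using (_∘_; id)
  open import Relation.Nullary using (does)
  open import Relation.Binary.PropositionalEquality
  open Enumeration
  open Probability
  open Summation

  sgn : Bool → ℤ
  sgn true  = 1ℤ
  sgn false = -1ℤ

  0≤i*i : ∀ i → 0ℤ ≤ i * i
  0≤i*i (+ n)            = subst (0ℤ ≤_) (pos-* n n) (+≤+ z≤n)
  0≤i*i ( -[1+ n ]) = +≤+ z≤n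

  imbalance : ∀ {t} → (Fin t → Bool) → Vec Bool t → ℤ
  imbalance {t} R b = ∑ (allFin t) (λ a → ⟦ R a ⟧ * sgn (lookup b a))

  -- For a uniform `b` the signs are independent with mean zero, so the expected square is the size
  -- of `R`, at most `t`. In the induction the cross terms cancel between the two values of the head
  -- bit.
  ∑-imbalance² : ∀ t (R : Fin t → Bool) →
    ∑ (vectors bools t) (λ b → imbalance R b * imbalance R b) ≤ + (2 ℕ.^ t ℕ.* t)
  ∑-imbalance² zero    R = ≤-refl
  ∑-imbalance² (suc t) R = begin
    ∑ (vectors bools (suc t)) (λ b → imbalance R b * imbalance R b)
      ≡⟨ ∑-cartesianProductWith (λ v a → a ∷ v) (vectors bools t) bools _ ⟩
    ∑ (vectors bools t) (λ b → sq (false ∷ b) + (sq (true ∷ b) + 0ℤ))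
      ≤⟨ ∑-mono (vectors bools t) perColumn ⟩
    ∑ (vectors bools t) (λ b → + 2 * (z b * z b) + + 2)
      ≡⟨ ∑-+ (vectors bools t) _ _ ⟩
    ∑ (vectors bools t) (λ b → + 2 * (z b * z b)) + ∑ (vectors bools t) (λ _ → + 2)
      ≡⟨ cong₂ _+_ (∑-* (vectors bools t) (+ 2) _)
                   (trans (∑-const (vectors bools t) (+ 2))
                          (cong (λ n → + n * + 2) (length-vectors bools t))) ⟩
    + 2 * ∑ (vectors bools t) (λ b → z b * z b) + + (2 ℕ.^ t) * + 2
      ≤⟨ +-monoˡ-≤ (+ (2 ℕ.^ t) * + 2) (*-monoˡ-≤-nonNeg (+ 2) (∑-imbalance² t (R ∘ suc))) ⟩
    + 2 * + (2 ℕ.^ t ℕ.* t) + + (2 ℕ.^ t) * + 2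
      ≡⟨ cong (λ i → + 2 * i + + (2 ℕ.^ t) * + 2) (pos-* (2 ℕ.^ t) t) ⟩
    + 2 * (+ (2 ℕ.^ t) * + t) + + (2 ℕ.^ t) * + 2
      ≡⟨ regroup (+ (2 ℕ.^ t)) (+ t) ⟩
    + 2 * + (2 ℕ.^ t) * (1ℤ + + t)
      ≡⟨ cong (_* + suc t) (pos-* 2 (2 ℕ.^ t)) ⟨
    + (2 ℕ.^ suc t) * + suc t
      ≡⟨ pos-* (2 ℕ.^ suc t) (suc t) ⟨
    + (2 ℕ.^ suc t ℕ.* suc t) ∎
    where
    open ≤-Reasoning
    z : Vec Bool t → ℤ
    z = imbalance (R ∘ suc)
    sq : Vec Bool (suc t) → ℤ
    sq b = imbalance R b * imbalance R b
    regroup : ∀ p n → + 2 * (p * n) + p * + 2 ≡ + 2 * p * (1ℤ + n)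
    regroup = solve-∀
    square : ∀ b i → imbalance R (b ∷ i) ≡ ⟦ R zero ⟧ * sgn b + z i
    square b i = ∑-allFin (λ a → ⟦ R a ⟧ * sgn (lookup (b ∷ i) a))
    expand : ∀ r i → (r * -1ℤ + i) * (r * -1ℤ + i) + ((r * 1ℤ + i) * (r * 1ℤ + i) + 0ℤ) ≡
                     + 2 * (i * i) + + 2 * (r * r)
    expand = solve-∀
    bound : ∀ r → + 2 * (⟦ r ⟧ * ⟦ r ⟧) ≤ + 2
    bound true  = ≤-refl
    bound false = +≤+ z≤n
    perColumn : ∀ b → sq (false ∷ b) + (sq (true ∷ b) + 0ℤ) ≤ + 2 * (z b * z b) + + 2
    perColumn b = begin
      sq (false ∷ b) + (sq (true ∷ b) + 0ℤ)
        ≡⟨ cong₂ (λ i j → i * i + (j * j + 0ℤ)) (square false b) (square true b) ⟩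
      (⟦ R zero ⟧ * -1ℤ + z b) * (⟦ R zero ⟧ * -1ℤ + z b) +
      ((⟦ R zero ⟧ * 1ℤ + z b) * (⟦ R zero ⟧ * 1ℤ + z b) + 0ℤ)
        ≡⟨ expand ⟦ R zero ⟧ (z b) ⟩
      + 2 * (z b * z b) + + 2 * (⟦ R zero ⟧ * ⟦ R zero ⟧)
        ≤⟨ +-monoʳ-≤ (+ 2 * (z b * z b)) (bound (R zero)) ⟩
      + 2 * (z b * z b) + + 2 ∎

  -- With `i = η` this bounds an imbalance linearly by its square, replacing Cauchy-Schwarz and its
  -- square root.
  2ij≤i²+j² : ∀ i j → + 2 * i * j ≤ j * j + i * i
  2ij≤i²+j² i j = 0≤i-j⇒j≤i (subst (0ℤ ≤_) (square i j) (0≤i*i (i - j)))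
    where
    square : ∀ i j → (i - j) * (i - j) ≡ j * j + i * i - + 2 * i * j
    square = solve-∀

  module Score {m n t : ℕ} (row : Fin t → Fin m) (column : Vec Bool t → Fin n) (u : Bool) where

    -- Summed in `score`, these signs count the right answers minus the wrong ones in the rectangle
    -- `R × S`. The rectangle is an argument because each message bit cuts it in two.
    term : Protocol m n → (Fin t → Bool) → (Vec Bool t → Bool) → Vec Bool t → Fin t → ℤ
    term π R S b a = ⟦ R a ⟧ * ⟦ S b ⟧ * (sgn (run π (row a) (column b)) * sgn (u xor lookup b a))

    score : Protocol m n → (Fin t → Bool) → (Vec Bool t → Bool) → ℤ
    score π R S = ∑ (vectors bools t) (λ b → ∑ (allFin t) (term π R S b))

    bound : ℕ → ℤ
    bound η = + (2 ℕ.^ t ℕ.* (t ℕ.+ η ℕ.* η))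

    -- A leaf answers with a constant, so a column in `S` scores plus or minus the imbalance of `R`
    -- and any other column scores 0. The inequality `2 η z ≤ z² + η²` then reduces the claim to the
    -- second moment.
    score-output : ∀ η o R S → + 2 * + η * score (output o) R S ≤ bound η
    score-output η o R S = begin
      + 2 * + η * score (output o) R S
        ≡⟨ ∑-* (vectors bools t) (+ 2 * + η) _ ⟨
      ∑ (vectors bools t) (λ b → + 2 * + η * ∑ (allFin t) (term (output o) R S b))
        ≤⟨ ∑-mono (vectors bools t) perColumn ⟩
      ∑ (vectors bools t) (λ b → imbalance R b * imbalance R b + + η * + η)
        ≡⟨ ∑-+ (vectors bools t) _ _ ⟩
      ∑ (vectors bools t) (λ b → imbalance R b * imbalance R b) +
      ∑ (vectors bools t) (λ _ → + η * + η)
        ≤⟨ +-mono-≤ (∑-imbalance² t R) (≤-reflexive constant) ⟩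
      + (2 ℕ.^ t ℕ.* t) + + (2 ℕ.^ t ℕ.* (η ℕ.* η))
        ≡⟨ cong +_ (ℕ.*-distribˡ-+ (2 ℕ.^ t) t (η ℕ.* η)) ⟨
      bound η ∎
      where
      open ≤-Reasoning
      constant : ∑ (vectors bools t) (λ _ → + η * + η) ≡ + (2 ℕ.^ t ℕ.* (η ℕ.* η))
      constant = trans (∑-const (vectors bools t) (+ η * + η))
        (trans (cong₂ (λ k i → + k * i) (length-vectors bools t) (sym (pos-* η η)))
               (sym (pos-* (2 ℕ.^ t) (η ℕ.* η))))

      sgn-xor : ∀ b c → sgn (b xor c) ≡ - sgn b * sgn c
      sgn-xor true  true  = refl
      sgn-xor true  false = refl
      sgn-xor false true  = refl
      sgn-xor false false = refl

      factor : ∀ r s o u c → r * s * (o * (- u * c)) ≡ s * (o * - u) * (r * c)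
      factor = solve-∀

      columnSum : ∀ b → ∑ (allFin t) (term (output o) R S b) ≡
                        ⟦ S b ⟧ * (sgn o * - sgn u) * imbalance R b
      columnSum b = trans
        (∑-cong (allFin t) (λ a →
          trans (cong (λ i → ⟦ R a ⟧ * ⟦ S b ⟧ * (sgn o * i)) (sgn-xor u (lookup b a)))
                (factor ⟦ R a ⟧ ⟦ S b ⟧ (sgn o) (sgn u) (sgn (lookup b a)))))
        (∑-* (allFin t) (⟦ S b ⟧ * (sgn o * - sgn u)) (λ a → ⟦ R a ⟧ * sgn (lookup b a)))

      coefficient : ∀ s o u i → + 2 * + η * (⟦ s ⟧ * (sgn o * - sgn u) * i) ≤ i * i + + η * + η
      coefficient s o u i = cases s o u
        where
        up : + 2 * + η * (1ℤ * i) ≤ i * i + + η * + η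
        up = subst (λ k → + 2 * + η * k ≤ i * i + + η * + η) (sym (*-identityˡ i))
                   (2ij≤i²+j² (+ η) i)

        down : + 2 * + η * (-1ℤ * i) ≤ i * i + + η * + η
        down = subst₂ (λ k l → + 2 * + η * k ≤ l + + η * + η) (sym (-1*i≡-i i)) (neg-square i)
                      (2ij≤i²+j² (+ η) (- i))
          where
          neg-square : ∀ i → - i * - i ≡ i * i
          neg-square = solve-∀

        nought : + 2 * + η * (0ℤ * i) ≤ i * i + + η * + η
        nought = subst (_≤ i * i + + η * + η) (sym (*-zeroʳ (+ 2 * + η)))
                       (+-mono-≤ (0≤i*i i) (0≤i*i (+ η)))

        cases : ∀ s o u → + 2 * + η * (⟦ s ⟧ * (sgn o * - sgn u) * i) ≤ i * i + + η * + η
        cases false true  true  = nought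
        cases false true  false = nought
        cases false false true  = nought
        cases false false false = nought
        cases true  true  true  = down
        cases true  true  false = up
        cases true  false true  = up
        cases true  false false = down

      perColumn : ∀ b → + 2 * + η * ∑ (allFin t) (term (output o) R S b) ≤
                        imbalance R b * imbalance R b + + η * + η
      perColumn b = subst (λ i → + 2 * + η * i ≤ imbalance R b * imbalance R b + + η * + η)
                          (sym (columnSum b)) (coefficient (S b) o u (imbalance R b))

    score-alice : ∀ f π₀ π₁ R S →
      score (alice f π₀ π₁) R S ≡
      score π₀ (λ a → R a ∧ not (f (row a))) S + score π₁ (λ a → R a ∧ f (row a)) S
    score-alice f π₀ π₁ R S =
      trans (∑-cong (vectors bools t) (λ b →
               trans (∑-cong (allFin t) (λ a →
                        split (R a) (f (row a)) ⟦ S b ⟧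
                              (run π₀ (row a) (column b)) (run π₁ (row a) (column b))
                              (sgn (u xor lookup b a))))
                     (∑-+ (allFin t) (term π₀ (λ a → R a ∧ not (f (row a))) S b)
                                     (term π₁ (λ a → R a ∧ f (row a)) S b))))
            (∑-+ (vectors bools t) _ _)
      where
      split : ∀ r x s o₀ o₁ c → ⟦ r ⟧ * s * (sgn (if x then o₁ else o₀) * c) ≡
        ⟦ r ∧ not x ⟧ * s * (sgn o₀ * c) + ⟦ r ∧ x ⟧ * s * (sgn o₁ * c)
      split false x     s o₀ o₁ c = refl
      split true  true  s o₀ o₁ c = sym (+-identityˡ _)
      split true  false s o₀ o₁ c = sym (+-identityʳ _)

    score-bob : ∀ f π₀ π₁ R S →
      score (bob f π₀ π₁) R S ≡
      score π₀ R (λ b → S b ∧ not (f (column b))) + score π₁ R (λ b → S b ∧ f (column b))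
    score-bob f π₀ π₁ R S =
      trans (∑-cong (vectors bools t) (λ b →
               trans (∑-cong (allFin t) (λ a →
                        split ⟦ R a ⟧ (f (column b)) (S b)
                              (run π₀ (row a) (column b)) (run π₁ (row a) (column b))
                              (sgn (u xor lookup b a))))
                     (∑-+ (allFin t) _ _)))
            (∑-+ (vectors bools t) _ _)
      where
      zero-middle : ∀ r c → r * 0ℤ * c ≡ 0ℤ
      zero-middle = solve-∀
      split : ∀ r x s o₀ o₁ c → r * ⟦ s ⟧ * (sgn (if x then o₁ else o₀) * c) ≡
        r * ⟦ s ∧ not x ⟧ * (sgn o₀ * c) + r * ⟦ s ∧ x ⟧ * (sgn o₁ * c)
      split r x     false o₀ o₁ c = trans (zero-middle r _)
        (sym (cong₂ _+_ (zero-middle r (sgn o₀ * c)) (zero-middle r (sgn o₁ * c))))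
      split r true  true  o₀ o₁ c =
        sym (trans (cong (_+ r * 1ℤ * (sgn o₁ * c)) (zero-middle r _)) (+-identityˡ _))
      split r false true  o₀ o₁ c =
        sym (trans (cong (_+_ (r * 1ℤ * (sgn o₀ * c))) (zero-middle r _)) (+-identityʳ _))

    double : ∀ η c {i j} → + 2 * + η * i ≤ + (2 ℕ.^ c) * bound η →
             + 2 * + η * j ≤ + (2 ℕ.^ c) * bound η →
             + 2 * + η * (i + j) ≤ + (2 ℕ.^ suc c) * bound η
    double η c {i} {j} p q = begin
      + 2 * + η * (i + j)                                 ≡⟨ *-distribˡ-+ (+ 2 * + η) i j ⟩
      + 2 * + η * i + + 2 * + η * j                       ≤⟨ +-mono-≤ p q ⟩
      + (2 ℕ.^ c) * bound η + + (2 ℕ.^ c) * bound η       ≡⟨ twice (+ (2 ℕ.^ c)) (bound η) ⟩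
      + 2 * + (2 ℕ.^ c) * bound η                         ≡⟨ cong (_* bound η) (pos-* 2 (2 ℕ.^ c)) ⟨
      + (2 ℕ.^ suc c) * bound η ∎
      where
      open ≤-Reasoning
      twice : ∀ p e → p * e + p * e ≡ + 2 * p * e
      twice = solve-∀

    -- A protocol of cost `c` cuts the rectangle into at most `2^c` leaf rectangles, each charged
    -- the full `bound η`; a leaf reached early is padded using `2^c ≥ 1`.
    score-bound : ∀ η c π R S → cost π ℕ.≤ c → + 2 * + η * score π R S ≤ + (2 ℕ.^ c) * bound η
    score-bound η c (output o) R S _ = begin
      + 2 * + η * score (output o) R S  ≤⟨ score-output η o R S ⟩
      bound η                           ≡⟨ *-identityˡ (bound η) ⟨
      1ℤ * bound η                      ≤⟨ *-monoʳ-≤-nonNeg (bound η) (+≤+ (ℕ.m^n>0 2 c)) ⟩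
      + (2 ℕ.^ c) * bound η ∎
      where open ≤-Reasoning
    score-bound η (suc c) (alice f π₀ π₁) R S (s≤s p) =
      subst (λ i → + 2 * + η * i ≤ + (2 ℕ.^ suc c) * bound η) (sym (score-alice f π₀ π₁ R S))
        (double η c (score-bound η c π₀ (λ a → R a ∧ not (f (row a))) S (ℕ.m⊔n≤o⇒m≤o _ _ p))
                    (score-bound η c π₁ (λ a → R a ∧ f (row a)) S (ℕ.m⊔n≤o⇒n≤o _ _ p)))
    score-bound η (suc c) (bob f π₀ π₁) R S (s≤s p) =
      subst (λ i → + 2 * + η * i ≤ + (2 ℕ.^ suc c) * bound η) (sym (score-bob f π₀ π₁ R S))
        (double η c (score-bound η c π₀ R (λ b → S b ∧ not (f (column b))) (ℕ.m⊔n≤o⇒m≤o _ _ p))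
                    (score-bound η c π₁ R (λ b → S b ∧ f (column b)) (ℕ.m⊔n≤o⇒n≤o _ _ p)))

  sgn-agree : ∀ b c → sgn b * sgn c ≡ + 2 * ⟦ does (b ≟ᵇ c) ⟧ - 1ℤ
  sgn-agree true  true  = refl
  sgn-agree true  false = refl
  sgn-agree false true  = refl
  sgn-agree false false = refl

  -- Success probability 2/3 means an expected sign agreement of at least 2/3 - 1/3 = 1/3, here
  -- multiplied through by three times the number of seeds.
  advantage : ∀ {m n} {M : Matrix m n} (Π : PublicCoinProtocol m n) x y →
    Pr[_,_outputs_] Π x y (M x y) ℚ.≥ + 2 ℚ./ 3 →
    + seeds Π ≤ + 3 * ∑ (allFin (seeds Π)) (λ r → sgn (run (protocol Π r) x y) * sgn (M x y))
  advantage {M = M} Π x y p = 0≤i-j⇒j≤i (subst (0ℤ ≤_) (sym eq)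
    (*-monoˡ-≤-nonNeg (+ 2) (i≤j⇒0≤j-i (/≥2/3⇒ k s {{seeds-nonZero Π}} p))))
    where
    s = seeds Π
    correct : Fin s → Bool
    correct r = does (run (protocol Π r) x y ≟ᵇ M x y)
    k = Vec.count (λ r → run (protocol Π r) x y ≟ᵇ M x y) (Vec.allFin s)
    sum : ∑ (allFin s) (λ r → sgn (run (protocol Π r) x y) * sgn (M x y)) ≡ + 2 * + k + + s * -1ℤ
    sum = trans (∑-cong (allFin s) (λ r → sgn-agree (run (protocol Π r) x y) (M x y)))
          (trans (∑-+ (allFin s) (λ r → + 2 * ⟦ correct r ⟧) (λ _ → -1ℤ))
          (cong₂ _+_ (trans (∑-* (allFin s) (+ 2) (⟦_⟧ ∘ correct))
                            (cong (_*_ (+ 2))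
                                  (sym (count≡∑ (λ r → run (protocol Π r) x y ≟ᵇ M x y) id))))
                     (trans (∑-const (allFin s) -1ℤ)
                            (cong (λ l → + l * -1ℤ) (length-tabulate {n = s} id)))))
    regroup : ∀ k s → + 3 * (+ 2 * k + s * -1ℤ) - s ≡ + 2 * (+ 3 * k - + 2 * s)
    regroup = solve-∀
    eq : + 3 * ∑ (allFin s) (λ r → sgn (run (protocol Π r) x y) * sgn (M x y)) - + s ≡
         + 2 * (+ 3 * + k - + 2 * + s)
    eq = trans (cong (λ i → + 3 * i - + s) sum) (regroup (+ k) (+ s))

  -- With t = η², each of the 2^c leaves has score at most 2^t η, so the advantage
  -- 1/3 on the t 2^t entries is out of reach once η > 3 · 2^c.
  scale : ℕ → ℕ
  scale c = suc (3 ℕ.* 2 ℕ.^ c)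

  dimension : ℕ → ℕ
  dimension c = scale c ℕ.* scale c

  -- The bit `u` admits the negated matrix, as a reduction may use a query with either orientation.
  ContainsIndex : ∀ {m n} → ℕ → Matrix m n → Set
  ContainsIndex {m} {n} t M =
    Σ[ row ∈ (Fin t → Fin m) ] Σ[ column ∈ (Vec Bool t → Fin n) ] ∃[ u ]
      ∀ a b → M (row a) (column b) ≡ u xor lookup b a

  -- The total sign agreement over all entries and seeds is counted twice: entry by entry
  -- `advantage` bounds it from below, seed by seed `score-bound` on the full rectangle bounds it
  -- from above.
  index-hard : ∀ c {m n} {M : Matrix m n} → R[ M ]≤ c → ¬ ContainsIndex (dimension c) M
  index-hard c {M = M} (Π , correct , cheap) (row , column , u , index) =
    -- As `t = η²`, `bound η` is `2 · 2^t · η²` and both ends of the chain are multiples of `X`.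
    -- Cancelling it leaves `η ≤ 3 · 2^c`, against `η = 3 · 2^c + 1`.
    ℕ.<-irrefl refl (drop‿+≤+ (*-cancelˡ-≤-pos (+ η) (+ (3 ℕ.* 2 ℕ.^ c)) X {{X>0}} (begin
      X * + η
        ≡⟨ lhs (+ s) (+ T) (+ η) ⟨
      + 2 * + η * (+ T * (+ η * + η * + s))
        ≤⟨ *-monoˡ-≤-nonNeg (+ 2 * + η) lower ⟩
      + 2 * + η * (+ 3 * ∑ (allFin s) fullScore)
        ≡⟨ commute (+ η) (∑ (allFin s) fullScore) ⟩
      + 3 * (+ 2 * + η * ∑ (allFin s) fullScore)
        ≡⟨ cong (_*_ (+ 3)) (∑-* (allFin s) (+ 2 * + η) fullScore) ⟨
      + 3 * (∑ (allFin s) (λ r → + 2 * + η * fullScore r))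
        ≤⟨ *-monoˡ-≤-nonNeg (+ 3) (∑-mono (allFin s) (λ r →
           score-bound η c (protocol Π r) (λ _ → true) (λ _ → true) (cheap r))) ⟩
      + 3 * (∑ (allFin s) (λ _ → + (2 ℕ.^ c) * bound η))
        ≡⟨ cong (_*_ (+ 3)) (∑-const (allFin s) (+ (2 ℕ.^ c) * bound η)) ⟩
      + 3 * (+ length (allFin s) * (+ (2 ℕ.^ c) * bound η))
        ≡⟨ cong₂ (λ n i → + 3 * (+ n * (+ (2 ℕ.^ c) * i))) (length-tabulate {n = s} id) bound≡ ⟩
      + 3 * (+ s * (+ (2 ℕ.^ c) * (+ T * (+ η * + η + + η * + η))))
        ≡⟨ rhs (+ s) (+ T) (+ η) (+ (2 ℕ.^ c)) ⟩
      X * (+ 3 * + (2 ℕ.^ c))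
        ≡⟨ cong (_*_ X) (pos-* 3 (2 ℕ.^ c)) ⟨
      X * + (3 ℕ.* 2 ℕ.^ c) ∎)))
    where
    open ≤-Reasoning
    open Score row column u
    s = seeds Π
    η = scale c
    t = dimension c
    T = 2 ℕ.^ t
    X = + 2 * (+ T * + η * + η * + s)

    fullScore : Fin s → ℤ
    fullScore r = score (protocol Π r) (λ _ → true) (λ _ → true)

    agreement : Vec Bool t → Fin t → Fin s → ℤ
    agreement b a r = sgn (run (protocol Π r) (row a) (column b)) * sgn (u xor lookup b a)

    exchange : ∑ (vectors bools t) (λ b → ∑ (allFin t) (λ a → ∑ (allFin s) (agreement b a))) ≡
               ∑ (allFin s) fullScore
    exchange =
      trans (∑-cong (vectors bools t) (λ b → ∑-swap (allFin t) (allFin s) (agreement b)))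
        (trans (∑-swap (vectors bools t) (allFin s) (λ b r → ∑ (allFin t) (λ a → agreement b a r)))
          (∑-cong (allFin s) (λ r → ∑-cong (vectors bools t) (λ b → ∑-cong (allFin t) (λ a →
            sym (*-identityˡ (agreement b a r)))))))

    lower : + T * (+ η * + η * + s) ≤ + 3 * ∑ (allFin s) fullScore
    lower = begin
      + T * (+ η * + η * + s)
        ≡⟨ cong (λ i → + T * (i * + s)) (pos-* η η) ⟨
      + T * (+ t * + s)
        ≡⟨ cong₂ (λ k l → + k * (+ l * + s)) (length-vectors bools t) (length-tabulate {n = t} id) ⟨
      + length (vectors bools t) * (+ length (allFin t) * + s)
        ≡⟨ ∑-const (vectors bools t) (+ length (allFin t) * + s) ⟨
      ∑ (vectors bools t) (λ _ → + length (allFin t) * + s)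
        ≡⟨ ∑-cong (vectors bools t) (λ _ → ∑-const (allFin t) (+ s)) ⟨
      ∑ (vectors bools t) (λ _ → ∑ (allFin t) (λ _ → + s))
        ≤⟨ ∑-mono (vectors bools t) (λ b → ∑-mono (allFin t) (λ a → perEntry a b)) ⟩
      ∑ (vectors bools t) (λ b → ∑ (allFin t) (λ a → + 3 * ∑ (allFin s) (agreement b a)))
        ≡⟨ ∑-cong (vectors bools t) (λ b →
             ∑-* (allFin t) (+ 3) (λ a → ∑ (allFin s) (agreement b a))) ⟩
      ∑ (vectors bools t) (λ b → + 3 * ∑ (allFin t) (λ a → ∑ (allFin s) (agreement b a)))
        ≡⟨ ∑-* (vectors bools t) (+ 3) (λ b → ∑ (allFin t) (λ a → ∑ (allFin s) (agreement b a))) ⟩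
      + 3 * ∑ (vectors bools t) (λ b → ∑ (allFin t) (λ a → ∑ (allFin s) (agreement b a)))
        ≡⟨ cong (_*_ (+ 3)) exchange ⟩
      + 3 * ∑ (allFin s) fullScore ∎
      where
      perEntry : ∀ a b → + s ≤ + 3 * ∑ (allFin s) (agreement b a)
      perEntry a b = subst
        (λ v → + s ≤ + 3 * ∑ (allFin s) (λ r → sgn (run (protocol Π r) (row a) (column b)) * sgn v))
        (index a b)
        (advantage {M = M} Π (row a) (column b) (correct (row a) (column b)))

    bound≡ : bound η ≡ + T * (+ η * + η + + η * + η)
    bound≡ = trans (pos-* T (t ℕ.+ η ℕ.* η)) (cong (λ i → + T * (i + i)) (pos-* η η))

    X>0 : Positive X
    X>0 = subst Positive
      (trans (pos-* 2 (T ℕ.* η ℕ.* η ℕ.* s)) (cong (_*_ (+ 2))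
        (trans (pos-* (T ℕ.* η ℕ.* η) s) (cong (_* + s)
          (trans (pos-* (T ℕ.* η) η) (cong (_* + η) (pos-* T η)))))))
      (positive (+<+ (ℕ.>-nonZero⁻¹ _ {{ℕ.m*n≢0 2 (T ℕ.* η ℕ.* η ℕ.* s) {{_}} {{nonZero}}}})))
      where
      nonZero : ℕ.NonZero (T ℕ.* η ℕ.* η ℕ.* s)
      nonZero =
        ℕ.m*n≢0 (T ℕ.* η ℕ.* η) s {{ℕ.m*n≢0 (T ℕ.* η) η {{ℕ.m*n≢0 T η {{ℕ.m^n≢0 2 t}}}}}}
          {{seeds-nonZero Π}}

    lhs : ∀ s t η → + 2 * η * (t * (η * η * s)) ≡ + 2 * (t * η * η * s) * η
    lhs = solve-∀
    rhs : ∀ s t η k → + 3 * (s * (k * (t * (η * η + η * η)))) ≡ + 2 * (t * η * η * s) * (+ 3 * k)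
    rhs = solve-∀
    commute : ∀ η i → + 2 * η * (+ 3 * i) ≡ + 3 * (+ 2 * η * i)
    commute = solve-∀

-- A constant-cost protocol for Hamming distance below a threshold.

module HammingProtocol where

  open import Data.Bool using (Bool; true; false; if_then_else_; not; _∧_; _∨_; _xor_)
  open import Data.Bool.Properties using (T-≡; xor-assoc; xor-comm; xor-annihilates-not)
    renaming (_≟_ to _≟ᵇ_)
  open import Data.Fin using (Fin; zero; suc)
  open import Data.Integer using (ℤ; +_; _+_; _*_; _-_; _≤_; 0ℤ; 1ℤ; -1ℤ; +≤+; +<+; positive)
  open import Data.Integer.Properties
  open import Data.Integer.Tactic.RingSolver using (solve-∀)
  open import Data.List using (List; length; allFin; cartesianProduct)
  import Data.List as List
  open import Data.List.Properties using (length-tabulate)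
  open import Data.Nat as ℕ using (ℕ; zero; suc; z≤n; s≤s; _<ᵇ_)
  import Data.Nat.Properties as ℕ
  import Data.Nat.Tactic.RingSolver as ℕ-Solver
  open import Data.Product using (_,_)
  open import Data.Rational as ℚ using ()
  open import Data.Vec as Vec
    using (Vec; []; _∷_; lookup; zipWith; replicate; head; tail; _[_]%=_)
  open import Data.Vec.Properties using (zipWith-assoc; zipWith-comm; zipWith-replicate)
  open import Function using (_∘_; id; Equivalence)
  open import Relation.Nullary using (does; yes; no; contradiction)
  open import Relation.Binary.PropositionalEquality
  open CubeEmbedding using (_⊕_; distance)
  open Enumeration
  open Probability
  open Ramsey using (weight)
  open Summation

  -- In continuation style, so that the rest of the protocol may depend on all the bits sent.
  announce : ∀ {m n} w → (Fin m → Vec Bool w) → (Vec Bool w → Protocol m n) → Protocol m n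
  announce zero    f k = k []
  announce (suc w) f k =
    alice (head ∘ f) (announce w (tail ∘ f) (k ∘ (false ∷_)))
                     (announce w (tail ∘ f) (k ∘ (true ∷_)))

  run-announce : ∀ {m n} w f (k : Vec Bool w → Protocol m n) x y →
                 run (announce w f k) x y ≡ run (k (f x)) x y
  run-announce zero    f k x y with [] ← f x = refl
  run-announce (suc w) f k x y with f x in eq
  ... | true ∷ v  = trans (run-announce w (tail ∘ f) (k ∘ (true ∷_)) x y)
                          (cong (λ v → run (k (true ∷ v)) x y) (cong tail eq))
  ... | false ∷ v = trans (run-announce w (tail ∘ f) (k ∘ (false ∷_)) x y)
                          (cong (λ v → run (k (false ∷ v)) x y) (cong tail eq))

  cost-announce : ∀ {m n} w f (k : Vec Bool w → Protocol m n) c →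
                  (∀ v → cost (k v) ℕ.≤ c) → cost (announce w f k) ℕ.≤ w ℕ.+ c
  cost-announce zero    f k c p = p []
  cost-announce (suc w) f k c p =
    s≤s (ℕ.⊔-lub (cost-announce w _ _ c (p ∘ (false ∷_))) (cost-announce w _ _ c (p ∘ (true ∷_))))

  announceBlocks : ∀ {m n q} B → (Fin m → Vec (Vec Bool q) B) →
                   (Vec (Vec Bool q) B → Protocol m n) → Protocol m n
  announceBlocks         zero    f k = k []
  announceBlocks {q = q} (suc B) f k =
    announce q (head ∘ f) (λ v → announceBlocks B (tail ∘ f) (k ∘ (v ∷_)))

  run-announceBlocks : ∀ {m n q} B f (k : Vec (Vec Bool q) B → Protocol m n) x y →
                       run (announceBlocks B f k) x y ≡ run (k (f x)) x y
  run-announceBlocks         zero    f k x y with [] ← f x = refl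
  run-announceBlocks {q = q} (suc B) f k x y =
    trans (run-announce q (head ∘ f) _ x y)
      (trans (run-announceBlocks B (tail ∘ f) _ x y)
             (cong (λ S → run (k S) x y) (η (f x))))
    where
    η : ∀ {A : Set} {n} (v : Vec A (suc n)) → head v ∷ tail v ≡ v
    η (x ∷ v) = refl

  cost-announceBlocks : ∀ {m n q} B f (k : Vec (Vec Bool q) B → Protocol m n) c →
                        (∀ S → cost (k S) ℕ.≤ c) → cost (announceBlocks B f k) ℕ.≤ B ℕ.* q ℕ.+ c
  cost-announceBlocks         zero    f k c p = p []
  cost-announceBlocks {q = q} (suc B) f k c p =
    ℕ.≤-trans (cost-announce q _ _ (B ℕ.* q ℕ.+ c) (λ v →
                 cost-announceBlocks B (tail ∘ f) (k ∘ (v ∷_)) c (p ∘ (v ∷_))))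
              (ℕ.≤-reflexive (sym (ℕ.+-assoc q (B ℕ.* q) c)))

  nonzero : ∀ {q} → Vec Bool q → Bool
  nonzero []      = false
  nonzero (b ∷ v) = b ∨ nonzero v

  support : ∀ {q B} → Vec (Vec Bool q) B → ℕ
  support S = weight (Vec.map nonzero S)

  Seed : ℕ → ℕ → Set
  Seed B q = Fin B × Vec Bool q

  add : ∀ {B q} → Seed B q → Vec (Vec Bool q) B → Vec (Vec Bool q) B
  add (h , v) S = S [ h ]%= (v ⊕_)

  -- Every coordinate of the input is hashed to one of B blocks and given a random
  -- label; a block holds the sum of the labels of its coordinates equal to 1.
  sketch : ∀ {B q L} → Vec (Seed B q) L → Vec Bool L → Vec (Vec Bool q) B
  sketch []       []          = replicate _ (replicate _ false)
  sketch (g ∷ gs) (true ∷ x)  = add g (sketch gs x)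
  sketch (g ∷ gs) (false ∷ x) = sketch gs x

  ⊕-cancelˡ : ∀ {n} (u v w : Vec Bool n) → (u ⊕ v) ⊕ (u ⊕ w) ≡ v ⊕ w
  ⊕-cancelˡ []          []      []      = refl
  ⊕-cancelˡ (false ∷ u) (b ∷ v) (c ∷ w) = cong (_ ∷_) (⊕-cancelˡ u v w)
  ⊕-cancelˡ (true ∷ u)  (b ∷ v) (c ∷ w) = cong₂ _∷_ (xor-annihilates-not b c) (⊕-cancelˡ u v w)

  ⊕-assoc : ∀ {n} (u v w : Vec Bool n) → (u ⊕ v) ⊕ w ≡ u ⊕ (v ⊕ w)
  ⊕-assoc u v w = zipWith-assoc xor-assoc u v w

  ⊕-comm : ∀ {n} (u v : Vec Bool n) → u ⊕ v ≡ v ⊕ u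
  ⊕-comm u v = zipWith-comm xor-comm u v

  _⊞_ : ∀ {q B} → Vec (Vec Bool q) B → Vec (Vec Bool q) B → Vec (Vec Bool q) B
  _⊞_ = zipWith _⊕_

  ⊞-comm : ∀ {q B} (S S′ : Vec (Vec Bool q) B) → S ⊞ S′ ≡ S′ ⊞ S
  ⊞-comm = zipWith-comm ⊕-comm

  -- A coordinate set in both strings puts the same label into the same block twice, and the two
  -- copies cancel.
  add-⊞-add : ∀ {B q} (g : Seed B q) S S′ → add g S ⊞ add g S′ ≡ S ⊞ S′
  add-⊞-add (zero , v)  (s ∷ S) (s′ ∷ S′) = cong (_∷ (S ⊞ S′)) (⊕-cancelˡ v s s′)
  add-⊞-add (suc h , v) (s ∷ S) (s′ ∷ S′) = cong ((s ⊕ s′) ∷_) (add-⊞-add (h , v) S S′)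

  add-⊞ : ∀ {B q} (g : Seed B q) S S′ → add g S ⊞ S′ ≡ add g (S ⊞ S′)
  add-⊞ (zero , v)  (s ∷ S) (s′ ∷ S′) = cong (_∷ (S ⊞ S′)) (⊕-assoc v s s′)
  add-⊞ (suc h , v) (s ∷ S) (s′ ∷ S′) = cong ((s ⊕ s′) ∷_) (add-⊞ (h , v) S S′)

  ⊞-add : ∀ {B q} (g : Seed B q) S S′ → S ⊞ add g S′ ≡ add g (S ⊞ S′)
  ⊞-add g S S′ = trans (⊞-comm S (add g S′)) (trans (add-⊞ g S′ S) (cong (add g) (⊞-comm S′ S)))

  zeros-⊞ : ∀ q B → replicate B (replicate q false) ⊞ replicate B (replicate q false) ≡
                    replicate B (replicate q false)
  zeros-⊞ q B = trans (zipWith-replicate _⊕_ (replicate q false) (replicate q false))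
                      (cong (replicate B) (zipWith-replicate _xor_ false false))

  -- Linearity over GF(2) lets Bob obtain the sketch of the difference from Alice's message, his own
  -- string and the shared seed.
  sketch-⊕ : ∀ {B q L} (gs : Vec (Seed B q) L) x y → sketch gs x ⊞ sketch gs y ≡ sketch gs (x ⊕ y)
  sketch-⊕ []       []          []          = zeros-⊞ _ _
  sketch-⊕ (g ∷ gs) (true ∷ x)  (true ∷ y) =
    trans (add-⊞-add g (sketch gs x) (sketch gs y)) (sketch-⊕ gs x y)
  sketch-⊕ (g ∷ gs) (true ∷ x)  (false ∷ y) =
    trans (add-⊞ g (sketch gs x) (sketch gs y)) (cong (add g) (sketch-⊕ gs x y))
  sketch-⊕ (g ∷ gs) (false ∷ x) (true ∷ y) =
    trans (⊞-add g (sketch gs x) (sketch gs y)) (cong (add g) (sketch-⊕ gs x y))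
  sketch-⊕ (g ∷ gs) (false ∷ x) (false ∷ y) = sketch-⊕ gs x y

  bit : Bool → ℕ
  bit true  = 1
  bit false = 0

  weight-∷ : ∀ {n} b (v : Vec Bool n) → weight (b ∷ v) ≡ bit b ℕ.+ weight v
  weight-∷ true  v = refl
  weight-∷ false v = refl

  -- Only block `h` changes; the old and new contributions of this block stand on opposite sides to
  -- avoid subtraction.
  support-add : ∀ {B q} (g@(h , v) : Seed B q) S →
                support (add g S) ℕ.+ bit (nonzero (lookup S h)) ≡
                support S ℕ.+ bit (nonzero (v ⊕ lookup S h))
  support-add (zero , v) (s ∷ S) = begin
    support ((v ⊕ s) ∷ S) ℕ.+ bit (nonzero s)
      ≡⟨ cong (ℕ._+ bit (nonzero s)) (weight-∷ (nonzero (v ⊕ s)) _) ⟩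
    bit (nonzero (v ⊕ s)) ℕ.+ support S ℕ.+ bit (nonzero s)
      ≡⟨ exchange (bit (nonzero (v ⊕ s))) (support S) (bit (nonzero s)) ⟩
    bit (nonzero s) ℕ.+ support S ℕ.+ bit (nonzero (v ⊕ s))
      ≡⟨ cong (ℕ._+ bit (nonzero (v ⊕ s))) (weight-∷ (nonzero s) _) ⟨
    support (s ∷ S) ℕ.+ bit (nonzero (v ⊕ s)) ∎
    where
    open ≡-Reasoning
    exchange : ∀ a b c → a ℕ.+ b ℕ.+ c ≡ c ℕ.+ b ℕ.+ a
    exchange = ℕ-Solver.solve-∀
  support-add (suc h , v) (s ∷ S) = begin
    support (s ∷ add (h , v) S) ℕ.+ bit (nonzero (lookup S h))
      ≡⟨ cong (ℕ._+ bit (nonzero (lookup S h))) (weight-∷ (nonzero s) _) ⟩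
    bit (nonzero s) ℕ.+ support (add (h , v) S) ℕ.+ bit (nonzero (lookup S h))
      ≡⟨ ℕ.+-assoc (bit (nonzero s)) _ _ ⟩
    bit (nonzero s) ℕ.+ (support (add (h , v) S) ℕ.+ bit (nonzero (lookup S h)))
      ≡⟨ cong (ℕ._+_ (bit (nonzero s))) (support-add (h , v) S) ⟩
    bit (nonzero s) ℕ.+ (support S ℕ.+ bit (nonzero (v ⊕ lookup S h)))
      ≡⟨ ℕ.+-assoc (bit (nonzero s)) _ _ ⟨
    bit (nonzero s) ℕ.+ support S ℕ.+ bit (nonzero (v ⊕ lookup S h))
      ≡⟨ cong (ℕ._+ bit (nonzero (v ⊕ lookup S h))) (weight-∷ (nonzero s) _) ⟨
    support (s ∷ S) ℕ.+ bit (nonzero (v ⊕ lookup S h)) ∎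
    where open ≡-Reasoning

  bit≤1 : ∀ b → bit b ℕ.≤ 1
  bit≤1 true  = ℕ.≤-refl
  bit≤1 false = z≤n

  support-add≤ : ∀ {B q} (g : Seed B q) S → support (add g S) ℕ.≤ suc (support S)
  support-add≤ g@(h , v) S = begin
    support (add g S)                                     ≤⟨ ℕ.m≤m+n _ _ ⟩
    support (add g S) ℕ.+ bit (nonzero (lookup S h))      ≡⟨ support-add g S ⟩
    support S ℕ.+ bit (nonzero (v ⊕ lookup S h))          ≤⟨ ℕ.+-monoʳ-≤ (support S) (bit≤1 _) ⟩
    support S ℕ.+ 1                                       ≡⟨ ℕ.+-comm (support S) 1 ⟩
    suc (support S)                                       ∎
    where open ℕ.≤-Reasoning

  nonzero-zeros : ∀ q → nonzero (replicate q false) ≡ false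
  nonzero-zeros zero    = refl
  nonzero-zeros (suc q) = nonzero-zeros q

  support-zeros : ∀ q B → support (replicate B (replicate q false)) ≡ 0
  support-zeros q zero    = refl
  support-zeros q (suc B) rewrite nonzero-zeros q = support-zeros q B

  -- Each coordinate equal to 1 touches a single block. This makes the error one-sided: strings
  -- below the threshold distance are always accepted.
  support≤weight : ∀ {B q L} (gs : Vec (Seed B q) L) z → support (sketch gs z) ℕ.≤ weight z
  support≤weight {B} {q} [] []      = ℕ.≤-reflexive (support-zeros q B)
  support≤weight (g ∷ gs) (true ∷ z)  =
    ℕ.≤-trans (support-add≤ g (sketch gs z)) (s≤s (support≤weight gs z))
  support≤weight (g ∷ gs) (false ∷ z) = support≤weight gs z

  <⇒<ᵇ≡true : ∀ {m n} → m ℕ.< n → (m <ᵇ n) ≡ true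
  <⇒<ᵇ≡true m<n = Equivalence.to T-≡ (ℕ.<⇒<ᵇ m<n)

  ≥⇒<ᵇ≡false : ∀ {m n} → n ℕ.≤ m → (m <ᵇ n) ≡ false
  ≥⇒<ᵇ≡false {m} {n} n≤m with m <ᵇ n in eq
  ... | true  = contradiction n≤m (ℕ.<⇒≱ (ℕ.<ᵇ⇒< m n (Equivalence.from T-≡ eq)))
  ... | false = refl

  0≤⟦_⟧ : ∀ b → 0ℤ ≤ ⟦ b ⟧
  0≤⟦ true ⟧  = +≤+ z≤n
  0≤⟦ false ⟧ = +≤+ z≤n

  ⟦_⟧≤1 : ∀ b → ⟦ b ⟧ ≤ 1ℤ
  ⟦ true ⟧≤1  = ≤-refl
  ⟦ false ⟧≤1 = +≤+ z≤n

  -- The only label that cancels `w` is `w` itself.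
  ∑-cancelling : ∀ {q} (w : Vec Bool q) → ∑ (vectors bools q) (λ v → ⟦ not (nonzero (v ⊕ w)) ⟧) ≡ 1ℤ
  ∑-cancelling []      = refl
  ∑-cancelling {suc q} (b ∷ w) =
    trans (∑-cartesianProductWith (λ v a → a ∷ v) (vectors bools q) bools _)
      (trans (∑-cong (vectors bools q) (λ v → split b (nonzero (v ⊕ w)))) (∑-cancelling w))
    where
    split : ∀ b n → ⟦ not (b ∨ n) ⟧ + (⟦ not (not b ∨ n) ⟧ + 0ℤ) ≡ ⟦ not n ⟧
    split true  true  = refl
    split true  false = refl
    split false true  = refl
    split false false = refl

  ∑-nonzero : ∀ {B q} (S : Vec (Vec Bool q) B) →
              ∑ (allFin B) (λ h → ⟦ nonzero (lookup S h) ⟧) ≡ + support S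
  ∑-nonzero []      = refl
  ∑-nonzero (s ∷ S) =
    trans (∑-allFin (λ h → ⟦ nonzero (lookup (s ∷ S) h) ⟧))
      (trans (cong (_+_ ⟦ nonzero s ⟧) (∑-nonzero S)) (count (nonzero s) (Vec.map nonzero S)))
    where
    count : ∀ {n} b (v : Vec Bool n) → ⟦ b ⟧ + + weight v ≡ + weight (b ∷ v)
    count true  v = refl
    count false v = refl

  module Sketching (q : ℕ) where

    -- `V` is both the number of blocks and the number of labels, so the seed of a coordinate is
    -- uniform among `V²` pairs.
    V : ℕ
    V = 2 ℕ.^ q

    pool : List (Seed V q)
    pool = cartesianProduct (allFin V) (vectors bools q)

    length-pool : + length pool ≡ + V * + V
    length-pool =
      trans (cong +_ (trans (length-cartesianProductWith _,_ (allFin V) (vectors bools q))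
                            (cong₂ ℕ._*_ (length-tabulate {n = V} id) (length-vectors bools q))))
            (pos-* V V)

    fails : Vec (Vec Bool q) V → ℕ → ℤ
    fails S j = ⟦ support S <ᵇ j ⟧

    -- A step fails to raise the support only if it hits a nonzero block or
    -- cancels the block it hits; the former is harmless above j.
    fails-add : ∀ j S → j ℕ.≤ support S → ∀ h v →
      fails (add (h , v) S) (suc j) ≤
      ⟦ support S <ᵇ suc j ⟧ * ⟦ nonzero (lookup S h) ⟧ + ⟦ not (nonzero (v ⊕ lookup S h)) ⟧
    fails-add j S j≤S h v
      with nonzero (v ⊕ lookup S h) | nonzero (lookup S h) | support-add (h , v) S
    ... | false | b | _ =
      ≤-trans ⟦ support (add (h , v) S) <ᵇ suc j ⟧≤1
              (+-monoˡ-≤ 1ℤ (subst (0ℤ ≤_) (⟦⟧-* (support S <ᵇ suc j) b)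
                                           0≤⟦ (support S <ᵇ suc j) ∧ b ⟧))
      where
      ⟦⟧-* : ∀ a b → ⟦ a ∧ b ⟧ ≡ ⟦ a ⟧ * ⟦ b ⟧
      ⟦⟧-* true  true  = refl
      ⟦⟧-* true  false = refl
      ⟦⟧-* false true  = refl
      ⟦⟧-* false false = refl
    ... | true | true  | eq =
      ≤-reflexive (trans (cong (λ m → ⟦ m <ᵇ suc j ⟧) (ℕ.+-cancelʳ-≡ 1 _ _ eq))
                         (sym (trans (+-identityʳ _) (*-identityʳ _))))
    ... | true | false | eq =
      ≤-reflexive (trans (cong ⟦_⟧ (≥⇒<ᵇ≡false enough))
                         (sym (trans (+-identityʳ _) (*-zeroʳ ⟦ support S <ᵇ suc j ⟧))))
      where
      enough : suc j ℕ.≤ support (add (h , v) S)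
      enough = subst (suc j ℕ.≤_)
        (trans (sym (ℕ.+-comm (support S) 1)) (trans (sym eq) (ℕ.+-identityʳ _))) (s≤s j≤S)

    -- If the support is already below `j`, all `V²` seeds are conceded. Otherwise hits on nonzero
    -- blocks matter only at support exactly `j`, giving at most `j V` bad seeds, and cancellation
    -- spoils one label for each of the `V` blocks.
    ∑-fails-add : ∀ j S →
      ∑ pool (λ g → fails (add g S) (suc j)) ≤ + V * + V * fails S j + + suc j * + V
    ∑-fails-add j S with support S <ᵇ j in eq
    ... | true = begin
      ∑ pool (λ g → fails (add g S) (suc j))
        ≤⟨ ∑-mono pool (λ g → ⟦ support (add g S) <ᵇ suc j ⟧≤1) ⟩
      ∑ pool (λ _ → 1ℤ)
        ≡⟨ ∑-const pool 1ℤ ⟩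
      + length pool * 1ℤ
        ≡⟨ cong (_* 1ℤ) length-pool ⟩
      + V * + V * 1ℤ
        ≡⟨ +-identityʳ _ ⟨
      + V * + V * 1ℤ + 0ℤ
        ≤⟨ +-monoʳ-≤ (+ V * + V * 1ℤ) (subst (0ℤ ≤_) (pos-* (suc j) V) (+≤+ z≤n)) ⟩
      + V * + V * 1ℤ + + suc j * + V ∎
      where open ≤-Reasoning
    ... | false = begin
      ∑ pool (λ g → fails (add g S) (suc j))
        ≡⟨ ∑-cartesianProductWith _,_ (allFin V) (vectors bools q) _ ⟩
      ∑ (allFin V) (λ h → ∑ (vectors bools q) (λ v → fails (add (h , v) S) (suc j)))
        ≤⟨ ∑-mono (allFin V) (λ h → ∑-mono (vectors bools q) (fails-add j S j≤S h)) ⟩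
      ∑ (allFin V) (λ h → ∑ (vectors bools q) (λ v →
        a * ⟦ nonzero (lookup S h) ⟧ + ⟦ not (nonzero (v ⊕ lookup S h)) ⟧))
        ≡⟨ ∑-cong (allFin V) perBlock ⟩
      ∑ (allFin V) (λ h → + V * a * ⟦ nonzero (lookup S h) ⟧ + 1ℤ)
        ≡⟨ ∑-+ (allFin V) (λ h → + V * a * ⟦ nonzero (lookup S h) ⟧) (λ _ → 1ℤ) ⟩
      ∑ (allFin V) (λ h → + V * a * ⟦ nonzero (lookup S h) ⟧) + ∑ (allFin V) (λ _ → 1ℤ)
        ≡⟨ cong₂ _+_ (trans (∑-* (allFin V) (+ V * a) (λ h → ⟦ nonzero (lookup S h) ⟧))
                            (cong (_*_ (+ V * a)) (∑-nonzero S)))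
                     (trans (∑-const (allFin V) 1ℤ)
                            (cong (λ n → + n * 1ℤ) (length-tabulate {n = V} id))) ⟩
      + V * a * + support S + + V * 1ℤ
        ≡⟨ regroup (+ V) a (+ support S) ⟩
      + V * (a * + support S) + + V
        ≤⟨ +-monoˡ-≤ (+ V) (*-monoˡ-≤-nonNeg (+ V) saturated) ⟩
      + V * + j + + V
        ≡⟨ collect (+ V) (+ j) ⟩
      + V * + V * 0ℤ + + suc j * + V ∎
      where
      open ≤-Reasoning
      a : ℤ
      a = ⟦ support S <ᵇ suc j ⟧
      j≤S : j ℕ.≤ support S
      j≤S with j ℕ.≤? support S
      ... | yes p = p
      ... | no ¬p = contradiction (trans (sym (<⇒<ᵇ≡true (ℕ.≰⇒> ¬p))) eq) λ ()
      saturated : a * + support S ≤ + j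
      saturated with support S ℕ.<? suc j
      ... | yes p = subst (λ b → ⟦ b ⟧ * + support S ≤ + j) (sym (<⇒<ᵇ≡true p))
        (≤-trans (≤-reflexive (*-identityˡ _)) (+≤+ (ℕ.s≤s⁻¹ p)))
      ... | no ¬p = subst (λ b → ⟦ b ⟧ * + support S ≤ + j) (sym (≥⇒<ᵇ≡false (ℕ.≮⇒≥ ¬p)))
        (+≤+ z≤n)
      perBlock : ∀ h →
        ∑ (vectors bools q) (λ v →
          a * ⟦ nonzero (lookup S h) ⟧ + ⟦ not (nonzero (v ⊕ lookup S h)) ⟧) ≡
        + V * a * ⟦ nonzero (lookup S h) ⟧ + 1ℤ
      perBlock h = trans (∑-+ (vectors bools q) (λ _ → a * ⟦ nonzero (lookup S h) ⟧) _)
        (cong₂ _+_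
          (trans (∑-const (vectors bools q) _)
            (trans (cong (λ n → + n * (a * ⟦ nonzero (lookup S h) ⟧)) (length-vectors bools q))
                   (sym (*-assoc (+ V) a _))))
          (∑-cancelling (lookup S h)))
      regroup : ∀ v a s → v * a * s + v * 1ℤ ≡ v * (a * s) + v
      regroup = solve-∀
      collect : ∀ v j → v * j + v ≡ v * v * 0ℤ + (1ℤ + j) * v
      collect = solve-∀

    V²-mono : ∀ {i j} → i ≤ j → + V * + V * i ≤ + V * + V * j
    V²-mono {i} {j} p = subst₂ _≤_ (cong (_* i) (pos-* V V)) (cong (_* j) (pos-* V V))
                                   (*-monoˡ-≤-nonNeg (+ (V ℕ.* V)) p)

    length-suc : ∀ L → + length (vectors pool (suc L)) ≡ + V * + V * + length (vectors pool L)
    length-suc L =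
      trans (cong +_ (length-cartesianProductWith (λ v a → a ∷ v) (vectors pool L) pool))
        (trans (pos-* (length (vectors pool L)) (length pool))
          (trans (*-comm (+ length (vectors pool L)) (+ length pool))
            (cong (_* + length (vectors pool L)) length-pool)))

    -- This is a failure probability of at most `j² / V`. Raising the target from `j - 1` to `j` at
    -- a coordinate equal to 1 adds at most `j / V`, and `1 + ... + j ≤ j²`. At target 0 nothing can
    -- fail, which covers surplus ones.
    ∑-fails : ∀ {L} j (z : Vec Bool L) → j ℕ.≤ weight z →
      + V * ∑ (vectors pool L) (λ gs → fails (sketch gs z) j) ≤
      + j * + j * + length (vectors pool L)
    ∑-fails {L} zero z _ = ≤-reflexive
      (trans (cong (_*_ (+ V)) (trans (∑-const (vectors pool L) 0ℤ)
                                      (*-zeroʳ (+ length (vectors pool L)))))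
             (*-zeroʳ (+ V)))
    ∑-fails {suc L} j@(suc j′) (true ∷ z) (s≤s p) = begin
      + V * ∑ (vectors pool (suc L)) (λ gs → fails (sketch gs (true ∷ z)) j)
        ≡⟨ cong (_*_ (+ V)) (∑-cartesianProductWith (λ v a → a ∷ v) (vectors pool L) pool _) ⟩
      + V * ∑ (vectors pool L) (λ gs → ∑ pool (λ g → fails (add g (sketch gs z)) j))
        ≤⟨ *-monoˡ-≤-nonNeg (+ V) (∑-mono (vectors pool L) (λ gs → ∑-fails-add j′ (sketch gs z))) ⟩
      + V * ∑ (vectors pool L) (λ gs → + V * + V * fails (sketch gs z) j′ + + j * + V)
        ≡⟨ cong (_*_ (+ V)) (trans (∑-+ (vectors pool L) _ _)
             (cong₂ _+_ (∑-* (vectors pool L) (+ V * + V) (λ gs → fails (sketch gs z) j′))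
                        (∑-const (vectors pool L) (+ j * + V)))) ⟩
      + V * (+ V * + V * F + l * (+ j * + V))
        ≡⟨ expand (+ V) F l (+ j) ⟩
      + V * + V * (+ V * F + + j * l)
        ≤⟨ V²-mono (+-monoˡ-≤ (+ j * l) (∑-fails j′ z p)) ⟩
      + V * + V * (+ j′ * + j′ * l + + j * l)
        ≡⟨ factor (+ V) l (+ j′) ⟩
      (+ j′ * + j′ + + j) * (+ V * + V * l)
        ≡⟨ cong (_*_ (+ j′ * + j′ + + j)) (length-suc L) ⟨
      (+ j′ * + j′ + + j) * + length (vectors pool (suc L))
        ≤⟨ *-monoʳ-≤-nonNeg (+ length (vectors pool (suc L)))
             -- `j²` equals `j′² + j + j′`, so there is a slack of `j′`.
             (≤-trans (i≤i+j (+ j′ * + j′ + + j) (+ j′)) (≤-reflexive (square (+ j′)))) ⟩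
      + j * + j * + length (vectors pool (suc L)) ∎
      where
      open ≤-Reasoning
      F l : ℤ
      F = ∑ (vectors pool L) (λ gs → fails (sketch gs z) j′)
      l = + length (vectors pool L)
      square : ∀ j → j * j + (1ℤ + j) + j ≡ (1ℤ + j) * (1ℤ + j)
      square = solve-∀
      expand : ∀ v f l j → v * (v * v * f + l * (j * v)) ≡ v * v * (v * f + j * l)
      expand = solve-∀
      factor : ∀ v l j → v * v * (j * j * l + (1ℤ + j) * l) ≡ (j * j + (1ℤ + j)) * (v * v * l)
      factor = solve-∀
    ∑-fails {suc L} j@(suc _) (false ∷ z) p = begin
      + V * ∑ (vectors pool (suc L)) (λ gs → fails (sketch gs (false ∷ z)) j)
        ≡⟨ cong (_*_ (+ V)) (trans
             (∑-cartesianProductWith (λ v a → a ∷ v) (vectors pool L) pool _)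
             (∑-cong (vectors pool L) (λ gs →
               trans (∑-const pool _) (cong (_* fails (sketch gs z) j) length-pool)))) ⟩
      + V * ∑ (vectors pool L) (λ gs → + V * + V * fails (sketch gs z) j)
        ≡⟨ cong (_*_ (+ V)) (∑-* (vectors pool L) (+ V * + V) (λ gs → fails (sketch gs z) j)) ⟩
      + V * (+ V * + V * F)
        ≡⟨ commute (+ V) F ⟩
      + V * + V * (+ V * F)
        ≤⟨ V²-mono (∑-fails j z p) ⟩
      + V * + V * (+ j * + j * l)
        ≡⟨ shift (+ V) (+ j) l ⟩
      + j * + j * (+ V * + V * l)
        ≡⟨ cong (_*_ (+ j * + j)) (length-suc L) ⟨
      + j * + j * + length (vectors pool (suc L)) ∎
      where
      open ≤-Reasoning
      F l : ℤ
      F = ∑ (vectors pool L) (λ gs → fails (sketch gs z) j)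
      l = + length (vectors pool L)
      commute : ∀ v f → v * (v * v * f) ≡ v * v * (v * f)
      commute = solve-∀
      shift : ∀ v j l → v * v * (j * j * l) ≡ j * j * (v * v * l)
      shift = solve-∀

  withinDistance : ∀ {L} → ℕ → Vec Bool L → Vec Bool L → Bool
  withinDistance j x y = distance x y <ᵇ j

  n<2^n : ∀ n → n ℕ.< 2 ℕ.^ n
  n<2^n zero    = s≤s z≤n
  n<2^n (suc n) = begin-strict
    suc n                    ≤⟨ n<2^n n ⟩
    2 ℕ.^ n                  <⟨ ℕ.m<m+n (2 ℕ.^ n) (ℕ.m^n>0 2 n) ⟩
    2 ℕ.^ n ℕ.+ 2 ℕ.^ n      ≡⟨ cong (ℕ._+_ (2 ℕ.^ n)) (ℕ.+-identityʳ (2 ℕ.^ n)) ⟨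
    2 ℕ.^ suc n ∎
    where open ℕ.≤-Reasoning

  module HammingDistance (j : ℕ) where

    -- Large enough for the failure probability j² / 2^q to be at most 1/3.
    q : ℕ
    q = 3 ℕ.* (j ℕ.* j)

    open Sketching q

    -- Alice sends `V` blocks of `q` bits and Bob one bit; the value depends on `j` alone and not on
    -- the length of the strings, as `BPP⁰` demands.
    hammingCost : ℕ
    hammingCost = V ℕ.* q ℕ.+ 1

    module _ {m n L} (x : Fin m → Vec Bool L) (y : Fin n → Vec Bool L) where

      M : Matrix m n
      M a b = withinDistance j (x a) (y b)

      decide : Vec (Seed V q) L → Vec (Vec Bool q) V → Protocol m n
      decide gs S = bob (λ b → support (S ⊞ sketch gs (y b)) <ᵇ j) (output false) (output true)

      compare : Vec (Seed V q) L → Protocol m n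
      compare gs = announceBlocks V (sketch gs ∘ x) (decide gs)

      run-compare : ∀ gs a b → run (compare gs) a b ≡ (support (sketch gs (x a ⊕ y b)) <ᵇ j)
      run-compare gs a b =
        trans (run-announceBlocks V (sketch gs ∘ x) (decide gs) a b)
          (trans (answer (support (sketch gs (x a) ⊞ sketch gs (y b)) <ᵇ j))
                 (cong (λ S → support S <ᵇ j) (sketch-⊕ gs (x a) (y b))))
        where
        answer : ∀ c → (if c then true else false) ≡ c
        answer true  = refl
        answer false = refl

      runs : List (Vec (Seed V q) L)
      runs = vectors pool L

      correct : Fin m → Fin n → Vec (Seed V q) L → Bool
      correct a b gs = does (run (compare gs) a b ≟ᵇ M a b)

      -- Near pairs are always answered correctly by `support≤weight`; a far pair is answered
      -- wrongly exactly when its sketch `fails`, which happens for at most a third of the seeds.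
      success : ∀ a b → + 2 * + length runs ≤ + 3 * ∑ runs (⟦_⟧ ∘ correct a b)
      success a b with distance (x a) (y b) ℕ.<? j
      ... | yes d<j = begin
        + 2 * + length runs
          ≤⟨ *-monoʳ-≤-nonNeg (+ length runs) (+≤+ (ℕ.n≤1+n 2)) ⟩
        + 3 * + length runs
          ≡⟨ cong (_*_ (+ 3)) (trans (∑-const runs 1ℤ) (*-identityʳ (+ length runs))) ⟨
        + 3 * ∑ runs (λ _ → 1ℤ)
          ≡⟨ cong (_*_ (+ 3)) (∑-cong runs always) ⟨
        + 3 * ∑ runs (⟦_⟧ ∘ correct a b) ∎
        where
        open ≤-Reasoning
        always : ∀ gs → ⟦ correct a b gs ⟧ ≡ 1ℤ
        always gs = cong₂ (λ c d → ⟦ does (c ≟ᵇ d) ⟧)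
          (trans (run-compare gs a b) (<⇒<ᵇ≡true (ℕ.≤-<-trans (support≤weight gs (x a ⊕ y b)) d<j)))
          (<⇒<ᵇ≡true d<j)
      ... | no d≮j = 0≤i-j⇒j≤i (subst (0ℤ ≤_) (sym difference) (i≤j⇒0≤j-i rare))
        where
        open ≤-Reasoning
        z : Vec Bool L
        z = x a ⊕ y b
        F : ℤ
        F = ∑ runs (λ gs → fails (sketch gs z) j)
        rare : + 3 * F ≤ + length runs
        rare = *-cancelˡ-≤-pos _ _ (+ V) {{positive (+<+ (ℕ.m^n>0 2 q))}} (begin
          + V * (+ 3 * F)
            ≡⟨ commute (+ V) F ⟩
          + 3 * (+ V * F)
            ≤⟨ *-monoˡ-≤-nonNeg (+ 3) (∑-fails j z (ℕ.≮⇒≥ d≮j)) ⟩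
          + 3 * (+ j * + j * + length runs)
            ≡⟨ assoc (+ j) (+ length runs) ⟩
          + 3 * (+ j * + j) * + length runs
            ≡⟨ cong (_* + length runs) (trans (pos-* 3 (j ℕ.* j)) (cong (_*_ (+ 3)) (pos-* j j))) ⟨
          + q * + length runs
            ≤⟨ *-monoʳ-≤-nonNeg (+ length runs) (+≤+ (ℕ.<⇒≤ (n<2^n q))) ⟩
          + V * + length runs ∎)
          where
          commute : ∀ v f → v * (+ 3 * f) ≡ + 3 * (v * f)
          commute = solve-∀
          assoc : ∀ j l → + 3 * (j * j * l) ≡ + 3 * (j * j) * l
          assoc = solve-∀
        complement : ∀ gs → ⟦ correct a b gs ⟧ ≡ 1ℤ + -1ℤ * fails (sketch gs z) j
        complement gs = trans
          (cong₂ (λ c d → ⟦ does (c ≟ᵇ d) ⟧) (run-compare gs a b) (≥⇒<ᵇ≡false (ℕ.≮⇒≥ d≮j)))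
          (negate (support (sketch gs z) <ᵇ j))
          where
          negate : ∀ c → ⟦ does (c ≟ᵇ false) ⟧ ≡ 1ℤ + -1ℤ * ⟦ c ⟧
          negate true  = refl
          negate false = refl
        difference : + 3 * ∑ runs (⟦_⟧ ∘ correct a b) - + 2 * + length runs ≡
                     + length runs - + 3 * F
        difference = trans
          (cong (λ i → + 3 * i - + 2 * + length runs)
            (trans (∑-cong runs complement)
              (trans (∑-+ runs (λ _ → 1ℤ) (λ gs → -1ℤ * fails (sketch gs z) j))
                (cong₂ _+_ (∑-const runs 1ℤ) (∑-* runs -1ℤ (λ gs → fails (sketch gs z) j))))))
          (regroup (+ length runs) F)
          where
          regroup : ∀ l f → + 3 * (l * 1ℤ + -1ℤ * f) - + 2 * l ≡ l - + 3 * f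
          regroup = solve-∀

      runs-nonZero : ℕ.NonZero (length runs)
      runs-nonZero = subst ℕ.NonZero (sym (length-vectors pool L))
        (ℕ.m^n≢0 (length pool) L {{pool-nonZero}})
        where
        pool-nonZero : ℕ.NonZero (length pool)
        pool-nonZero = subst ℕ.NonZero (sym (+-injective (trans length-pool (sym (pos-* V V)))))
                         (ℕ.m*n≢0 V V {{ℕ.m^n≢0 2 q}} {{ℕ.m^n≢0 2 q}})

      comparison : PublicCoinProtocol m n
      comparison = record
        { seeds         = length runs
        ; seeds-nonZero = runs-nonZero
        ; protocol      = compare ∘ List.lookup runs
        }

      R-withinDistance : R[ M ]≤ hammingCost
      R-withinDistance = comparison , probable , λ r → cheap (List.lookup runs r)
        where
        probable : ∀ a b → Pr[_,_outputs_] comparison a b (M a b) ℚ.≥ + 2 ℚ./ 3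
        probable a b = ⇒/≥2/3 successes (length runs) {{runs-nonZero}}
          (subst (λ i → + 2 * + length runs ≤ + 3 * i) (sym tally) (success a b))
          where
          successes : ℕ
          successes = Vec.count (λ r → run (compare (List.lookup runs r)) a b ≟ᵇ M a b)
                                (Vec.allFin (length runs))
          tally : + successes ≡ ∑ runs (⟦_⟧ ∘ correct a b)
          tally = trans (count≡∑ (λ r → run (compare (List.lookup runs r)) a b ≟ᵇ M a b) id)
                        (∑-lookup runs (⟦_⟧ ∘ correct a b))
        cheap : ∀ gs → cost (compare gs) ℕ.≤ hammingCost
        cheap gs = cost-announceBlocks V (sketch gs ∘ x) (decide gs) 1 (λ S → ℕ.≤-refl)

-- From a complete problem to an index matrix inside one of its matrices.

module Reduction where

  open import Data.Bool using (Bool; true; false; not; _xor_)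
  open import Data.Bool.Properties using (xor-identityʳ)
  open import Data.Fin using (Fin; zero; suc; toℕ; fromℕ<; pinch)
  open import Data.Fin.Permutation using (_⟨$⟩ʳ_)
  open import Data.Fin.Properties using (toℕ-fromℕ<)
  open import Data.List using (List; []; _∷_; _++_; length; map)
  open import Data.List.Membership.Propositional using (_∈_)
  open import Data.List.Membership.Propositional.Properties using (∈-map⁺; ∈-++⁺ˡ; ∈-++⁺ʳ)
  open import Data.List.Properties using (length-map; length-++)
  open import Data.List.Relation.Unary.Any using (here; there)
  open import Data.Nat
    using (ℕ; zero; suc; _+_; _*_; _^_; _≤_; _<_; _<ᵇ_; z≤n; s≤s; ⌊_/2⌋)
  open import Data.Nat.Logarithm using (⌊log₂_⌋; ⌊log₂[2^n]⌋≡n)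
  open import Data.Nat.Properties
  open import Data.Product using (_,_)
  open import Data.Vec using (Vec; []; _∷_; lookup; replicate; _[_]≔_)
  open import Function using (_∘_; case_of_)
  open import Relation.Nullary using (contradiction)
  open import Relation.Binary.PropositionalEquality
  open CubeEmbedding
  open HammingProtocol
  open IndexMatrix using (ContainsIndex)
  open Ramsey

  odd : ℕ → Bool
  odd zero    = false
  odd (suc n) = not (odd n)

  odd-n+n : ∀ n → odd (n + n) ≡ false
  odd-n+n zero    = refl
  odd-n+n (suc n) rewrite +-suc n n | odd-n+n n = refl

  bits : ∀ L → ℕ → Vec Bool L
  bits zero    n = []
  bits (suc L) n = odd n ∷ bits L ⌊ n /2⌋

  code : ∀ {L} → Vec Bool L → ℕ
  code []          = 0
  code (false ∷ v) = code v + code v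
  code (true ∷ v)  = suc (code v + code v)

  bits-code : ∀ {L} (v : Vec Bool L) → bits L (code v) ≡ v
  bits-code []          = refl
  bits-code (false ∷ v) = cong₂ _∷_ (odd-n+n (code v))
    (trans (cong (bits _) (sym (n≡⌊n+n/2⌋ (code v)))) (bits-code v))
  bits-code (true ∷ v)  = cong₂ _∷_ (cong not (odd-n+n (code v)))
    (trans (cong (bits _) (sym (n≡⌈n+n/2⌉ (code v)))) (bits-code v))

  code<2^L : ∀ {L} (v : Vec Bool L) → code v < 2 ^ L
  code<2^L []                  = s≤s z≤n
  code<2^L {suc L} (false ∷ v) rewrite +-identityʳ (2 ^ L) = +-mono-< (code<2^L v) (code<2^L v)
  code<2^L {suc L} (true ∷ v)  rewrite +-identityʳ (2 ^ L) =
    ≤-trans (s≤s (≤-reflexive (sym (+-suc (code v) (code v))))) (+-mono-≤ (code<2^L v) (code<2^L v))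

  encode : ∀ {L} → Vec Bool L → Fin (2 ^ L)
  encode v = fromℕ< (code<2^L v)

  -- The N × N matrix compares all strings of length log₂ N when N is a power of
  -- two, and only such N matter.
  hammingProblem : ℕ → CommunicationProblem
  hammingProblem j N a b =
    withinDistance j (bits ⌊log₂ N ⌋ (toℕ a)) (bits ⌊log₂ N ⌋ (toℕ b))

  hammingProblem∈BPP⁰ : ∀ j → BPP⁰ (hammingProblem j)
  hammingProblem∈BPP⁰ j = HammingDistance.hammingCost j , λ N → HammingDistance.R-withinDistance j
      (λ a → bits ⌊log₂ N ⌋ (toℕ a)) (λ b → bits ⌊log₂ N ⌋ (toℕ b))

  hammingProblem-encode : ∀ j {L} (v w : Vec Bool L) →
    hammingProblem j (2 ^ L) (encode v) (encode w) ≡ withinDistance j v w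
  hammingProblem-encode j {L} v w =
    trans (cong₂ (λ a b → withinDistance j (bits ⌊log₂ 2 ^ L ⌋ a) (bits ⌊log₂ 2 ^ L ⌋ b))
                 (toℕ-fromℕ< (code<2^L v)) (toℕ-fromℕ< (code<2^L w)))
      (trans (cong (λ l → withinDistance j (bits l (code v)) (bits l (code w))) (⌊log₂[2^n]⌋≡n L))
             (cong₂ (withinDistance j) (bits-code v) (bits-code w)))

  queries : ∀ {ℳ : MatrixSet} {N} → OracleProtocol ℳ N → List (Matrix N N)
  queries (leaf _)          = []
  queries (query Q _ T₀ T₁) = Q ∷ queries T₀ ++ queries T₁

  -- The strict inequality carries the induction: it leaves room for the root beside the two
  -- subtrees.
  length-queries : ∀ {ℳ : MatrixSet} {N} (T : OracleProtocol ℳ N) d →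
                   depth {ℳ} T ≤ d → length (queries {ℳ} T) < 2 ^ d
  length-queries (leaf _) d p = m^n>0 2 d
  length-queries {ℳ} (query Q _ T₀ T₁) (suc d) (s≤s p) = begin-strict
    suc (length (queries {ℳ} T₀ ++ queries {ℳ} T₁))
      ≡⟨ cong suc (length-++ (queries {ℳ} T₀)) ⟩
    suc (length (queries {ℳ} T₀)) + length (queries {ℳ} T₁)
      <⟨ +-mono-≤-< (length-queries {ℳ} T₀ d (m⊔n≤o⇒m≤o _ _ p))
                    (length-queries {ℳ} T₁ d (m⊔n≤o⇒n≤o _ _ p)) ⟩
    2 ^ d + 2 ^ d
      ≡⟨ cong (2 ^ d +_) (+-identityʳ (2 ^ d)) ⟨
    2 ^ suc d ∎
    where open ≤-Reasoning

  -- Inputs with different outputs reach different leaves, and the query at the node where their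
  -- paths part is the witness.
  distinguishing-query : ∀ {ℳ : MatrixSet} {N} (T : OracleProtocol ℳ N) x y x′ y′ →
    runOracle {ℳ} T x y ≢ runOracle {ℳ} T x′ y′ →
    ∃[ Q ] Q ∈ queries {ℳ} T × QS ℳ Q × Q x y ≢ Q x′ y′
  distinguishing-query (leaf b) x y x′ y′ differ = contradiction refl differ
  distinguishing-query {ℳ} (query Q Q∈QS T₀ T₁) x y x′ y′ differ
    with Q x y in eq | Q x′ y′ in eq′
  ... | true  | false = Q , here refl , Q∈QS , λ e → case trans (sym eq) (trans e eq′) of λ ()
  ... | false | true  = Q , here refl , Q∈QS , λ e → case trans (sym eq) (trans e eq′) of λ ()
  ... | true  | true
    with Q′ , Q′∈ , rest ← distinguishing-query {ℳ} T₁ x y x′ y′ differ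
    = Q′ , there (∈-++⁺ʳ (queries {ℳ} T₀) Q′∈) , rest
  ... | false | false
    with Q′ , Q′∈ , rest ← distinguishing-query {ℳ} T₀ x y x′ y′ differ
    = Q′ , there (∈-++⁺ˡ Q′∈) , rest

  -- Each operation precomposes with maps of row and column indices, so an index matrix found in a
  -- query is also found in a matrix of `𝒬`.
  QS-reindexes : ∀ {𝒬 m n} {Q : Matrix m n} → QS (Matrices 𝒬) Q →
    ∃[ N ] ∃[ f ] ∃[ g ] ∀ i j → Q i j ≡ 𝒬 N (f i) (g j)
  QS-reindexes (member (matrix N)) = N , (λ i → i) , (λ j → j) , λ _ _ → refl
  QS-reindexes (permute σ τ q) with N , f , g , e ← QS-reindexes q =
    N , f ∘ (σ ⟨$⟩ʳ_) , g ∘ (τ ⟨$⟩ʳ_) , λ i j → e _ _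
  QS-reindexes (submatrix f′ g′ _ _ q) with N , f , g , e ← QS-reindexes q =
    N , f ∘ f′ , g ∘ g′ , λ i j → e _ _
  QS-reindexes (duplicateRow r q) with N , f , g , e ← QS-reindexes q =
    N , f ∘ pinch r , g , λ i j → e _ _
  QS-reindexes (duplicateColumn c q) with N , f , g , e ← QS-reindexes q =
    N , f , g ∘ pinch c , λ i j → e _ _
  QS-reindexes (pointwise M≡M′ q) with N , f , g , e ← QS-reindexes q =
    N , f , g , λ i j → trans (sym (M≡M′ i j)) (e i j)

  full : ∀ n → Vec Bool n
  full n = replicate n true

  coSingleton : ∀ {n} → Fin n → Vec Bool n
  coSingleton a = full _ [ a ]≔ false

  full-∪ : ∀ {n} (b : Vec Bool n) → full n ∪ b ≡ full n
  full-∪ []      = refl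
  full-∪ (x ∷ b) = cong (true ∷_) (full-∪ b)

  weight-full : ∀ n → weight (full n) ≡ n
  weight-full zero    = refl
  weight-full (suc n) = cong suc (weight-full n)

  coSingleton-∪-∋ : ∀ {n} (a : Fin n) b → lookup b a ≡ true → coSingleton a ∪ b ≡ full n
  coSingleton-∪-∋ zero    (true ∷ b) refl = cong (true ∷_) (full-∪ b)
  coSingleton-∪-∋ (suc a) (x ∷ b)    e    = cong (true ∷_) (coSingleton-∪-∋ a b e)

  weight-coSingleton-∪ : ∀ {n} (a : Fin (suc n)) b → lookup b a ≡ false →
                         weight (coSingleton a ∪ b) ≡ n
  weight-coSingleton-∪ {n}     zero    (false ∷ b) refl =
    trans (cong weight (full-∪ b)) (weight-full n)
  weight-coSingleton-∪ {suc n} (suc a) (x ∷ b)     e    =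
    cong suc (weight-coSingleton-∪ a b e)

  -- Rows and columns of the embedded cube whose union is everything are at
  -- distance 2 (suc t), the pairs whose union misses one element at distance 2 t.
  reduction⇒index : ∀ 𝒬 t → D[ 𝒬 , hammingProblem (suc t * 2) ]=O[1] →
                    ∃[ N ] ContainsIndex (suc t) (𝒬 N)
  reduction⇒index 𝒬 t (d , computable)
    -- `L` depends only on `d` and `t`, so it is fixed before the protocol `T` for size `2 ^ L` is
    -- obtained; `2 ^ d` bounds the number of queries of any such protocol.
    with L , embed ← embedding (2 ^ d) t (suc t)
    with T , computes , shallow ← computable (2 ^ L)
    = answer
    where
    ℳ : MatrixSet
    ℳ = Matrices 𝒬

    onStrings : Matrix (2 ^ L) (2 ^ L) → Vec Bool L → Vec Bool L → Bool
    onStrings Q v w = Q (encode v) (encode w)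

    E : Embedding t (suc t) L (map onStrings (queries {ℳ} T))
    E = embed (map onStrings (queries {ℳ} T))
          (≤-trans (≤-reflexive (length-map onStrings (queries {ℳ} T)))
                   (<⇒≤ (length-queries {ℳ} T d shallow)))

    open Embedding E

    rowOf columnOf : Vec Bool (suc t) → Fin (2 ^ L)
    rowOf x    = encode (row x)
    columnOf y = encode (column y)

    all hole none : Vec Bool (suc t)
    all  = full (suc t)
    hole = coSingleton zero
    none = replicate (suc t) false

    run-embedded : ∀ x y → runOracle {ℳ} T (rowOf x) (columnOf y) ≡
                           (weight (x ∪ y) * 2 <ᵇ suc t * 2)
    run-embedded x y =
      trans (computes (rowOf x) (columnOf y))
        (trans (hammingProblem-encode (suc t * 2) (row x) (column y))
               (cong (_<ᵇ suc t * 2) (distance-embedded x y)))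

    far : runOracle {ℳ} T (rowOf all) (columnOf all) ≡ false
    far = trans (run-embedded all all)
      (trans (cong (λ w → w * 2 <ᵇ suc t * 2)
                   (trans (cong weight (full-∪ all)) (weight-full (suc t))))
             (≥⇒<ᵇ≡false {suc t * 2} ≤-refl))

    near : runOracle {ℳ} T (rowOf hole) (columnOf none) ≡ true
    near = trans (run-embedded hole none)
      (trans (cong (λ w → w * 2 <ᵇ suc t * 2) (weight-coSingleton-∪ zero none refl))
             (<⇒<ᵇ≡true (*-monoˡ-< 2 (n<1+n t))))

    answer : ∃[ N ] ContainsIndex (suc t) (𝒬 N)
    answer
      with Q , Q∈ , Q∈QS , differ ←
        distinguishing-query {ℳ} T (rowOf all) (columnOf all) (rowOf hole) (columnOf none)
          (λ e → case trans (sym far) (trans e near) of λ ())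
      with N , f , g , reindex ← QS-reindexes Q∈QS
      -- The negation bit is the common value of `Q` on all unions of size `t`.
      = N , f ∘ rowOf ∘ coSingleton , g ∘ columnOf , Q (rowOf hole) (columnOf none) ,
        λ a b → trans (sym (reindex (rowOf (coSingleton a)) (columnOf b))) (index a b)
      where
      index : ∀ a b → Q (rowOf (coSingleton a)) (columnOf b) ≡
                      Q (rowOf hole) (columnOf none) xor lookup b a
      index a b with lookup b a in eq
      -- Here the union is everything, so `Q` takes its value at the far pair; it differs from the
      -- value at the near pair and is therefore its negation.
      ... | true  = trans
        (invariant (∈-map⁺ onStrings Q∈) (coSingleton a) b all all
          (trans (coSingleton-∪-∋ a b eq) (sym (full-∪ all))))
        (opposite differ)
        where
        opposite : ∀ {b c} → b ≢ c → b ≡ c xor true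
        opposite {true}  {true}  b≢c = contradiction refl b≢c
        opposite {true}  {false} b≢c = refl
        opposite {false} {true}  b≢c = refl
        opposite {false} {false} b≢c = contradiction refl b≢c
      ... | false = trans
        (homogeneous (∈-map⁺ onStrings Q∈) (coSingleton a) b hole none
          (weight-coSingleton-∪ a b eq) (weight-coSingleton-∪ zero none refl))
        (sym (xor-identityʳ _))

  complete⇒index : ∀ 𝒬 t → (∀ 𝒫 → BPP⁰ 𝒫 → D[ 𝒬 , 𝒫 ]=O[1]) →
                   ∃[ N ] ContainsIndex (suc t) (𝒬 N)
  complete⇒index 𝒬 t complete = reduction⇒index 𝒬 t
    (complete (hammingProblem (suc t * 2)) (hammingProblem∈BPP⁰ (suc t * 2)))

open import Data.Nat using (pred)
open import Data.Product using (_,_)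
open IndexMatrix
open Reduction

theorem1p1 : ¬ (∃[ 𝒬 ] (BPP⁰ 𝒬 × (∀ (𝒫 : CommunicationProblem) → BPP⁰ 𝒫 → D[ 𝒬 , 𝒫 ]=O[1])))
theorem1p1 (𝒬 , (c , R𝒬≤c) , complete) =
  -- `dimension c` is a product of successors and reduces to a successor, so
  -- `suc (pred (dimension c))` computes back to it.
  let N , contains = complete⇒index 𝒬 (pred (dimension c)) complete
  in index-hard c (R𝒬≤c N) contains
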